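{- Let $n$ be large and let $B\ge\log n$ be an integer space parameter. Consider a stream whose final frequency vector is the Zipfian vector $f\in\mathbb{R}^n$ with $f_i=1/i$, and suppose we have a heavy-hitter oracle that correctly identifies the top $B/2$ heavy hitters, i.e., for every $i\in[n]$ it correctly reports whether $i\le B/2$. Consider the following algorithm. Let $T=\Theta(\log\log n)$. It maintains independent CountSketch tables $S_1,\dots,S_{T-1}$, each with $3$ rows and $\frac{B}{12T}$ columns, and $S_T$ with $3$ rows and $\frac{B}{12}$ columns. For each stream update $(i,\Delta)$: if $i$ is a top $B/2$ heavy hitter, its frequency is maintained exactly (in separate storage); otherwise $(i,\Delta)$ is fed into all $T$ tables. To answer a query for $i$: if $i$ is a top $B/2$ heavy hitter, output its exactly maintained frequency; otherwise let $\hat f_i^{\,j}$ be the CountSketch estimate from table $S_j$, let $\tilde f_i=\mathrm{Median}(\hat f_i^{\,1},\dots,\hat f_i^{\,T-1})$, and output $\hat f_i=0$ if $\tilde f_i<\tau$ where $\tau=\Theta(\log\log n)/B$, and $\hat f_i=\hat f_i^{\,T}$ otherwise. Then, for suitable choices of the absolute constants hidden in $T$ and $\tau$, the expected weighted error satisfies $$\mathbb{E}\left[\frac{1}{N}\sum_{i=1}^n f_i\,|f_i-\hat f_i|\right]=O\left(\frac{1}{B\log n}\right),$$ where $N=\sum_{i=1}^n f_i$.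
   Context: A stream consists of updates $(i,\Delta)$ with $i\in[n]$, $\Delta\in\mathbb{R}$; the final frequency vector $f$ has $f_i$ equal to the sum of the updates to coordinate $i$. A CountSketch table with $k$ rows and $w$ columns uses independent, uniformly random hash functions $h_1,\dots,h_k:[n]\to[w]$ and signs $s_1,\dots,s_k:[n]\to\{ -1,1\}$, maintains $C[\ell,b]=\sum_{j}[h_\ell(j)=b]\,s_\ell(j)g_j$ where $g$ is the vector of updates fed to the table, and estimates coordinate $i$ by $\mathrm{median}_{\ell\in[k]}\,s_\ell(i)\,C[\ell,h_\ell(i)]$. The expectation is over the randomness of the tables. -}

module Defs where

open import Data.Bool using (Bool; true; false; if_then_else_)
open import Data.Nat as ℕ using (ℕ; zero; suc; _∸_; _≤ᵇ_)
open import Data.Nat.Logarithm using (⌊log₂_⌋)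
open import Data.Fin as Fin using (Fin; toℕ)
open import Data.List as List using (List; []; _∷_; concatMap; length)
open import Data.Vec as Vec using (Vec)
open import Data.Product using (_×_; _,_)
open import Data.Integer as ℤ using (+_)
open import Data.Rational as Q using (ℚ; mkℚ; 0ℚ; 1ℚ; _+_; _*_; _-_; ∣_∣; _÷_)
open import Data.Rational.Properties using (≤-decTotalOrder; _<?_)
open import Data.List.Sort.InsertionSort.Base ≤-decTotalOrder using (sort)
open import Relation.Nullary.Decidable using (does)

ℕ→ℚ : ℕ → ℚ
ℕ→ℚ m = + m Q./ 1


-- total division on ℚ (x ⊘ 0 = 0; only used where the denominator is > 0)
_⊘_ : ℚ → ℚ → ℚ
p ⊘ mkℚ (+ zero) _ _ = 0ℚ
p ⊘ q@(mkℚ (+ suc _) _ _) = p ÷ q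
p ⊘ q@(mkℚ ℤ.-[1+ _ ] _ _) = p ÷ q

_div_ : ℕ → ℕ → ℕ
m div zero = 0
m div suc k = m ℕ./ suc k

sumFin : (n : ℕ) → (Fin n → ℚ) → ℚ
sumFin zero    g = 0ℚ
sumFin (suc n) g = g Fin.zero + sumFin n (λ j → g (Fin.suc j))

sumList : List ℚ → ℚ
sumList = List.foldr _+_ 0ℚ

nth : List ℚ → ℕ → ℚ
nth []       _       = 0ℚ
nth (x ∷ xs) zero    = x
nth (x ∷ xs) (suc k) = nth xs k

-- Median of a list of rationals: middle element of the sorted list
-- (odd length), average of the two middle elements (even length),
-- 0 for the empty list.
median : List ℚ → ℚ
median xs with sort xs | length xs
... | ys | m with m ℕ.% 2
...   | zero = (nth ys (m ℕ./ 2 ∸ 1) + nth ys (m ℕ./ 2)) * (+ 1 Q./ 2)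
...   | suc _ = nth ys (m ℕ./ 2)

mean : List ℚ → ℚ
mean []       = 0ℚ
mean (x ∷ xs) = sumList (x ∷ xs) * (+ 1 Q./ suc (length xs))

allFns : {A : Set} (n : ℕ) → List A → List (Fin n → A)
allFns zero    xs = (λ ()) ∷ []
allFns (suc n) xs =
  concatMap (λ a → List.map (λ f → λ { Fin.zero → a ; (Fin.suc j) → f j })
                            (allFns n xs)) xs

allVecs : {A : Set} (m : ℕ) → List A → List (Vec A m)
allVecs zero    xs = Vec.[] ∷ []
allVecs (suc m) xs =
  concatMap (λ a → List.map (λ v → a Vec.∷ v) (allVecs m xs)) xs

_⊗_ : {A B : Set} → List A → List B → List (A × B)
xs ⊗ ys = concatMap (λ a → List.map (λ b → (a , b)) ys) xs

sgn : Bool → ℚ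
sgn true  = 1ℚ
sgn false = Q.- 1ℚ

-- one row: hash function h : [n] → [w] and sign function s : [n] → {±1}
Row : ℕ → ℕ → Set
Row n w = (Fin n → Fin w) × (Fin n → Bool)

Table : ℕ → ℕ → Set
Table n w = Vec (Row n w) 3

allRows : (n w : ℕ) → List (Row n w)
allRows n w = allFns n (List.allFin w) ⊗ allFns n (true ∷ false ∷ [])

allTables : (n w : ℕ) → List (Table n w)
allTables n w = allVecs 3 (allRows n w)

-- s(i) · C[h(i)] where C[b] = Σ_j [h j = b] s(j) g(j)
rowEstimate : {n w : ℕ} → Row n w → (Fin n → ℚ) → Fin n → ℚ
rowEstimate {n} (h , s) g i =
  sgn (s i) * sumFin n (λ j → if does (h j Fin.≟ h i) then sgn (s j) * g j else 0ℚ)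

csEstimate : {n w : ℕ} → Table n w → (Fin n → ℚ) → Fin n → ℚ
csEstimate t g i = median (Vec.toList (Vec.map (λ r → rowEstimate r g i) t))

-- The setting of the theorem (coordinate i : Fin n stands for i+1 ∈ [n])

zipf : {n : ℕ} → Fin n → ℚ
zipf i = + 1 Q./ suc (toℕ i)

heavy : ℕ → {n : ℕ} → Fin n → Bool
heavy B i = suc (toℕ i) ≤ᵇ (B ℕ./ 2)

fed : ℕ → {n : ℕ} → Fin n → ℚ
fed B i = if heavy B i then 0ℚ else zipf i

lg : ℕ → ℕ
lg n = ⌊log₂ n ⌋

lglg : ℕ → ℕ
lglg n = ⌊log₂ ⌊log₂ n ⌋ ⌋

numTables : ℕ → ℕ → ℕ
numTables cT n = cT ℕ.* lglg n

colsSmall : (cT n B : ℕ) → ℕ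
colsSmall cT n B = 1 ℕ.⊔ (B div (12 ℕ.* numTables cT n))

colsBig : ℕ → ℕ
colsBig B = 1 ℕ.⊔ (B div 12)

Config : (cT n B : ℕ) → Set
Config cT n B = Vec (Table n (colsSmall cT n B)) (numTables cT n ∸ 1) × Table n (colsBig B)

allConfigs : (cT n B : ℕ) → List (Config cT n B)
allConfigs cT n B =
  allVecs (numTables cT n ∸ 1) (allTables n (colsSmall cT n B)) ⊗ allTables n (colsBig B)

threshold : ℚ → ℕ → ℕ → ℚ
threshold cτ n B = cτ * (ℕ→ℚ (lglg n) ⊘ ℕ→ℚ B)

answer : (cT : ℕ) (cτ : ℚ) (n B : ℕ) → Config cT n B → Fin n → ℚ
answer cT cτ n B (small , big) i =
  if heavy B i then zipf i
  else (if does (med <? threshold cτ n B) then 0ℚ else csEstimate big (fed B) i)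
  where
  med = median (Vec.toList (Vec.map (λ t → csEstimate t (fed B) i) small))

totalMass : ℕ → ℚ
totalMass n = sumFin n (zipf {n})

weightedError : (cT : ℕ) (cτ : ℚ) (n B : ℕ) → Config cT n B → ℚ
weightedError cT cτ n B c =
  sumFin n (λ i → zipf i * ∣ zipf i - answer cT cτ n B c i ∣) ⊘ totalMass n

-- expectation over independent uniform hash/sign functions of all tables
expectedWeightedError : (cT : ℕ) (cτ : ℚ) (n B : ℕ) → ℚ
expectedWeightedError cT cτ n B =
  mean (List.map (weightedError cT cτ n B) (allConfigs cT n B))

{-# OPTIONS --safe #-}
module Submission where

-- Only second moments are needed. A row's error at i is, up to sign, Σ_{j≠i} [h j = h i] s_j g_j, so its
-- second moment is at most ‖g‖²/w, and ‖fed‖² ≤ 4/B. The median of three rows inherits three times this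
-- bound, so E|f̂ᵀ − f| = O(1/B), whereas a small table exceeds τ = Θ(lglg n / B) ≥ 2 f_i only with small
-- constant probability. Every table is charged a weight that is at least 1/4, at least 4 when its estimate
-- exceeds τ, and at most 1/2 in expectation; when the median of the small tables reaches τ the product of the
-- weights is at least 1, so by independence this has probability at most 2^-(T-1) = O(1/lg n).
-- Answering 0 costs Σ_{i > B/2} f_i² = O(1/B) in total, and otherwise one pays
-- Σ_i f_i · O(1/lg n) · O(1/B) = O(1/B). Dividing by N ≥ lg n / 2 gives the theorem.

open import Defs
open import Data.Nat using (ℕ; _≤_; _<_)
open import Data.Product using (Σ; _×_; ∃-syntax)
open import Data.Rational using (ℚ; Positive) renaming (_≤_ to _≤ℚ_; _*_ to _*ℚ_)

open import Data.Bool using (Bool; true; false; if_then_else_; T)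
open import Data.Fin as Fin using (Fin; toℕ)
import Data.Fin.Properties as Finₚ
open import Data.Integer as ℤ using (ℤ)
import Data.Integer.Properties as ℤₚ
open import Data.List as List using (List; []; _∷_; concatMap; length; _++_)
import Data.List.Properties as Listₚ
open import Data.List.Membership.Propositional using (_∈_)
import Data.List.Relation.Binary.Permutation.Propositional as ↭
open ↭ using (_↭_)
import Data.List.Relation.Binary.Permutation.Propositional.Properties as ↭ₚ
open import Data.List.Relation.Unary.Any using (here; there)
import Data.List.Relation.Unary.Linked as Linked
open import Data.Maybe using (Maybe; just; nothing)
open import Data.Nat as ℕ using (zero; suc; z≤n; s≤s)
import Data.Nat.DivMod as ℕₘ
import Data.Nat.Divisibility as ℕ∣
open import Data.Nat.Logarithm using (⌊log₂⌋-mono-≤; ⌊log₂[2^n]⌋≡n; ⌊log₂⌊n/2⌋⌋≡⌊log₂n⌋∸1)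
import Data.Nat.Properties as ℕₚ
open import Data.Nat.Tactic.RingSolver using () renaming (solve-∀ to ℕ-solve-∀)
open import Data.Product using (_,_)
open import Data.Rational as ℚ
  using (mkℚ; 0ℚ; 1ℚ; ½; _+_; _*_; _-_; ∣_∣; _/_; nonNegative; positive; toℚᵘ; *<*)
  renaming (_<_ to _<ℚ_)
import Data.Rational.Properties as ℚₚ
import Data.Rational.Unnormalised as ℚᵘ
import Data.Rational.Unnormalised.Properties as ℚᵘₚ
open import Data.Sum using (inj₁; inj₂)
open import Data.Vec as Vec using (Vec)
import Data.Vec.Properties as Vecₚ
open import Function using (_∘_)
open import Relation.Binary.Bundles using (DecTotalOrder)
open import Relation.Binary.PropositionalEquality
open import Relation.Nullary using (Dec; yes; no; contradiction; does)
open import Relation.Nullary.Decidable using (dec-true)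
open import Tactic.RingSolver using (solve-∀)
open import Tactic.RingSolver.Core.AlmostCommutativeRing using (AlmostCommutativeRing; fromCommutativeRing)

open import Data.List.Relation.Unary.Sorted.TotalOrder (DecTotalOrder.totalOrder ℚₚ.≤-decTotalOrder) using (Sorted)
open import Data.List.Sort.InsertionSort.Base ℚₚ.≤-decTotalOrder using (sort)
open import Data.List.Sort.InsertionSort.Properties ℚₚ.≤-decTotalOrder using (sort-↭; sort-↗)

-- Arithmetic of ℚ

-- The weights play the part of the exponential moment in a Chernoff bound, but a quadratic weight
-- is enough, and its expectation is read off from the second moment of a table. The values 1/4 and
-- 4 are reciprocal, so an estimate above the threshold makes up for one below it. A small table has
-- only about B/T columns, which raises its second moment by a factor T; the threshold also carries
-- a factor T, and its square outweighs that loss. The event that the median reaches the threshold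
-- is never given a probability: the product of weights dominates its indicator and depends on the
-- small tables alone, so its expectation multiplies with that of the error of the large table.
-- There are no square roots in ℚ, so the step from E e² to E|e| uses |e| ≤ 1/B + B e² in place of
-- Cauchy-Schwarz, balanced at the scale 1/B of the error.

ℚ-ring : AlmostCommutativeRing _ _
ℚ-ring = fromCommutativeRing ℚₚ.+-*-commutativeRing isZero?
  where
  isZero? : ∀ x → Maybe (0ℚ ≡ x)
  isZero? x with 0ℚ ℚₚ.≟ x
  ... | yes p = just p
  ... | no  _ = nothing

sq : ℚ → ℚ
sq x = x * x

*-monoˡ : ∀ r {p q} → 0ℚ ≤ℚ r → p ≤ℚ q → r * p ≤ℚ r * q
*-monoˡ r 0≤r = ℚₚ.*-monoˡ-≤-nonNeg r {{nonNegative 0≤r}}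

*-monoʳ : ∀ r {p q} → 0ℚ ≤ℚ r → p ≤ℚ q → p * r ≤ℚ q * r
*-monoʳ r 0≤r = ℚₚ.*-monoʳ-≤-nonNeg r {{nonNegative 0≤r}}

*-mono : ∀ {p q r s} → 0ℚ ≤ℚ q → 0ℚ ≤ℚ r → p ≤ℚ q → r ≤ℚ s → p * r ≤ℚ q * s
*-mono {q = q} {r = r} 0≤q 0≤r p≤q r≤s = ℚₚ.≤-trans (*-monoʳ r 0≤r p≤q) (*-monoˡ q 0≤q r≤s)

0≤+ : ∀ {p q} → 0ℚ ≤ℚ p → 0ℚ ≤ℚ q → 0ℚ ≤ℚ p + q
0≤+ = ℚₚ.+-mono-≤

0≤* : ∀ {p q} → 0ℚ ≤ℚ p → 0ℚ ≤ℚ q → 0ℚ ≤ℚ p * q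
0≤* {p} {q} 0≤p 0≤q = subst (_≤ℚ p * q) (ℚₚ.*-zeroʳ p) (*-monoˡ p 0≤p 0≤q)

neg*neg : ∀ x → ℚ.- x * ℚ.- x ≡ x * x
neg*neg = solve-∀ ℚ-ring

0≤sq : ∀ x → 0ℚ ≤ℚ sq x
0≤sq x with ℚₚ.≤-total 0ℚ x
... | inj₁ 0≤x = 0≤* 0≤x 0≤x
... | inj₂ x≤0 = subst (0ℚ ≤ℚ_) (neg*neg x) (0≤* (ℚₚ.neg-antimono-≤ x≤0) (ℚₚ.neg-antimono-≤ x≤0))

sq-∣-∣ : ∀ x → sq ∣ x ∣ ≡ sq x
sq-∣-∣ x with ℚₚ.∣p∣≡p∨∣p∣≡-p x
... | inj₁ eq = cong sq eq
... | inj₂ eq = trans (cong sq eq) (neg*neg x)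

≤-from-diff : ∀ {p q} → 0ℚ ≤ℚ q - p → p ≤ℚ q
≤-from-diff {p} {q} h = subst₂ _≤ℚ_ (ℚₚ.+-identityʳ p) (p+[q-p] p q) (ℚₚ.+-monoʳ-≤ p h)
  where
  p+[q-p] : ∀ p q → p + (q - p) ≡ q
  p+[q-p] = solve-∀ ℚ-ring

-- For closed `p` and `q` the hidden argument is settled by evaluating the difference, so numerical
-- inequalities need no proof term.
≤-numeral : ∀ p q {_ : ℚ.NonNegative (q - p)} → p ≤ℚ q
≤-numeral p q {h} = ≤-from-diff (ℚₚ.nonNegative⁻¹ (q - p) {{h}})

-- `_/_` divides out a gcd that does not reduce on variables, so identities about fractions are
-- proved among unnormalised rationals and transported back.
toℚᵘ-/ : ∀ i d → toℚᵘ (i / suc d) ℚᵘ.≃ ℚᵘ.mkℚᵘ i d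
toℚᵘ-/ i d = ℚₚ.toℚᵘ-fromℚᵘ (ℚᵘ.mkℚᵘ i d)

ℕ→ℚ-+ : ∀ m n → ℕ→ℚ (m ℕ.+ n) ≡ ℕ→ℚ m + ℕ→ℚ n
ℕ→ℚ-+ m n = ℚₚ.toℚᵘ-injective (begin
  toℚᵘ (ℕ→ℚ (m ℕ.+ n))                ≈⟨ toℚᵘ-/ (ℤ.+ (m ℕ.+ n)) 0 ⟩
  ℚᵘ.mkℚᵘ (ℤ.+ (m ℕ.+ n)) 0             ≈⟨ ℚᵘ.*≡* (cong (ℤ._* ℤ.+ 1)
                                           (sym (cong₂ ℤ._+_ (ℤₚ.*-identityʳ (ℤ.+ m)) (ℤₚ.*-identityʳ (ℤ.+ n))))) ⟩
  ℚᵘ.mkℚᵘ (ℤ.+ m) 0 ℚᵘ.+ ℚᵘ.mkℚᵘ (ℤ.+ n) 0 ≈⟨ ℚᵘₚ.≃-sym (ℚᵘₚ.+-cong (toℚᵘ-/ (ℤ.+ m) 0) (toℚᵘ-/ (ℤ.+ n) 0)) ⟩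
  toℚᵘ (ℕ→ℚ m) ℚᵘ.+ toℚᵘ (ℕ→ℚ n)      ≈⟨ ℚᵘₚ.≃-sym (ℚₚ.toℚᵘ-homo-+ (ℕ→ℚ m) (ℕ→ℚ n)) ⟩
  toℚᵘ (ℕ→ℚ m + ℕ→ℚ n)                ∎)
  where open import Relation.Binary.Reasoning.Setoid ℚᵘₚ.≃-setoid

ℕ→ℚ-* : ∀ m n → ℕ→ℚ (m ℕ.* n) ≡ ℕ→ℚ m * ℕ→ℚ n
ℕ→ℚ-* m n = ℚₚ.toℚᵘ-injective (begin
  toℚᵘ (ℕ→ℚ (m ℕ.* n))                ≈⟨ toℚᵘ-/ (ℤ.+ (m ℕ.* n)) 0 ⟩
  ℚᵘ.mkℚᵘ (ℤ.+ (m ℕ.* n)) 0             ≈⟨ ℚᵘ.*≡* (cong (ℤ._* ℤ.+ 1) (ℤₚ.pos-* m n)) ⟩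
  ℚᵘ.mkℚᵘ (ℤ.+ m) 0 ℚᵘ.* ℚᵘ.mkℚᵘ (ℤ.+ n) 0 ≈⟨ ℚᵘₚ.≃-sym (ℚᵘₚ.*-cong (toℚᵘ-/ (ℤ.+ m) 0) (toℚᵘ-/ (ℤ.+ n) 0)) ⟩
  toℚᵘ (ℕ→ℚ m) ℚᵘ.* toℚᵘ (ℕ→ℚ n)      ≈⟨ ℚᵘₚ.≃-sym (ℚₚ.toℚᵘ-homo-* (ℕ→ℚ m) (ℕ→ℚ n)) ⟩
  toℚᵘ (ℕ→ℚ m * ℕ→ℚ n)                ∎)
  where open import Relation.Binary.Reasoning.Setoid ℚᵘₚ.≃-setoid

0≤ℕ→ℚ : ∀ n → 0ℚ ≤ℚ ℕ→ℚ n
0≤ℕ→ℚ n = ℚₚ.nonNegative⁻¹ (ℕ→ℚ n) {{ℚₚ.normalize-nonNeg n 1}}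

0<ℕ→ℚ : ∀ n → 0ℚ <ℚ ℕ→ℚ (suc n)
0<ℕ→ℚ n = ℚₚ.positive⁻¹ (ℕ→ℚ (suc n)) {{ℚₚ.normalize-pos (suc n) 1}}

ℕ→ℚ-mono : ∀ {m n} → m ≤ n → ℕ→ℚ m ≤ℚ ℕ→ℚ n
ℕ→ℚ-mono {m} {n} m≤n = subst₂ _≤ℚ_ (ℚₚ.+-identityʳ (ℕ→ℚ m))
  (trans (sym (ℕ→ℚ-+ m (n ℕ.∸ m))) (cong ℕ→ℚ (ℕₚ.m+[n∸m]≡n m≤n)))
  (ℚₚ.+-monoʳ-≤ (ℕ→ℚ m) (0≤ℕ→ℚ (n ℕ.∸ m)))

0≤1/ : ∀ n → 0ℚ ≤ℚ ℤ.+ 1 / suc n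
0≤1/ n = ℚₚ.nonNegative⁻¹ (ℤ.+ 1 / suc n) {{ℚₚ.normalize-nonNeg 1 (suc n)}}

1/*n≡1 : ∀ n → (ℤ.+ 1 / suc n) * ℕ→ℚ (suc n) ≡ 1ℚ
1/*n≡1 n = ℚₚ.toℚᵘ-injective (begin
  toℚᵘ ((ℤ.+ 1 / suc n) * ℕ→ℚ (suc n))             ≈⟨ ℚₚ.toℚᵘ-homo-* (ℤ.+ 1 / suc n) (ℕ→ℚ (suc n)) ⟩
  toℚᵘ (ℤ.+ 1 / suc n) ℚᵘ.* toℚᵘ (ℕ→ℚ (suc n))     ≈⟨ ℚᵘₚ.*-cong (toℚᵘ-/ (ℤ.+ 1) n) (toℚᵘ-/ (ℤ.+ suc n) 0) ⟩
  ℚᵘ.mkℚᵘ (ℤ.+ 1) n ℚᵘ.* ℚᵘ.mkℚᵘ (ℤ.+ suc n) 0        ≈⟨ ℚᵘ.*≡* (trans (ℤₚ.*-identityʳ (ℤ.+ 1 ℤ.* ℤ.+ suc n))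
                                                     (sym (cong (λ k → ℤ.+ 1 ℤ.* ℤ.+ k) (ℕₚ.*-identityʳ (suc n))))) ⟩
  ℚᵘ.1ℚᵘ                                        ∎)
  where open import Relation.Binary.Reasoning.Setoid ℚᵘₚ.≃-setoid

⊘-as-* : ∀ p q → p ⊘ q ≡ p * (1ℚ ⊘ q)
⊘-as-* p (mkℚ (ℤ.+ zero) d c) = sym (ℚₚ.*-zeroʳ p)
⊘-as-* p q@(mkℚ ℤ.+[1+ _ ] _ _) = cong (p *_) (sym (ℚₚ.*-identityˡ (ℚ.1/ q)))
⊘-as-* p q@(mkℚ ℤ.-[1+ _ ] _ _) = cong (p *_) (sym (ℚₚ.*-identityˡ (ℚ.1/ q)))

⊘-inverse : ∀ q → 0ℚ <ℚ q → (1ℚ ⊘ q) * q ≡ 1ℚ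
⊘-inverse (mkℚ (ℤ.+ zero) _ _) (*<* (ℤ.+<+ ()))
⊘-inverse q@(mkℚ ℤ.+[1+ _ ] _ _) _ =
  trans (cong (_* q) (ℚₚ.*-identityˡ (ℚ.1/ q))) (ℚₚ.*-inverseˡ q)
⊘-inverse (mkℚ ℤ.-[1+ _ ] _ _) (*<* ())

*-cancelʳ : ∀ r {p q} → 0ℚ <ℚ r → p * r ≤ℚ q * r → p ≤ℚ q
*-cancelʳ r 0<r = ℚₚ.*-cancelʳ-≤-pos r {{positive 0<r}}

0≤1⊘ : ∀ q → 0ℚ <ℚ q → 0ℚ ≤ℚ 1ℚ ⊘ q
0≤1⊘ q 0<q = *-cancelʳ q 0<q
  (subst₂ _≤ℚ_ (sym (ℚₚ.*-zeroˡ q)) (sym (⊘-inverse q 0<q)) (≤-numeral 0ℚ 1ℚ))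

-- Expectations over lists

-- 1/n, with the junk value 1/0 = 0 making it multiplicative without side conditions.
recip : ℕ → ℚ
recip zero    = 0ℚ
recip (suc n) = ℤ.+ 1 / suc n

0≤recip : ∀ n → 0ℚ ≤ℚ recip n
0≤recip zero    = ℚₚ.≤-refl
0≤recip (suc n) = 0≤1/ n

recip-* : ∀ m n → recip (m ℕ.* n) ≡ recip m * recip n
recip-* zero    n       = sym (ℚₚ.*-zeroˡ (recip n))
recip-* (suc m) zero    = trans (cong recip (ℕₚ.*-zeroʳ m)) (sym (ℚₚ.*-zeroʳ (recip (suc m))))
recip-* (suc m) (suc n) = begin
  u                       ≡⟨ ℚₚ.*-identityʳ u ⟨
  u * 1ℚ                  ≡⟨ cong₂ (λ x y → u * (x * y)) (1/*n≡1 m) (1/*n≡1 n) ⟨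
  u * ((v * p) * (w * q)) ≡⟨ rearrange u v p w q ⟩
  (u * (p * q)) * (v * w) ≡⟨ cong (λ x → u * x * (v * w)) (ℕ→ℚ-* (suc m) (suc n)) ⟨
  (u * ℕ→ℚ (suc m ℕ.* suc n)) * (v * w) ≡⟨ cong (_* (v * w)) (1/*n≡1 (n ℕ.+ m ℕ.* suc n)) ⟩
  1ℚ * (v * w)            ≡⟨ ℚₚ.*-identityˡ (v * w) ⟩
  v * w                   ∎
  where
  open ≡-Reasoning
  u = recip (suc m ℕ.* suc n)
  v = recip (suc m)
  w = recip (suc n)
  p = ℕ→ℚ (suc m)
  q = ℕ→ℚ (suc n)
  rearrange : ∀ u v p w q → u * ((v * p) * (w * q)) ≡ (u * (p * q)) * (v * w)
  rearrange = solve-∀ ℚ-ring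

private variable
  A B : Set

Σₗ : List A → (A → ℚ) → ℚ
Σₗ xs φ = sumList (List.map φ xs)

Σₗ-mono : ∀ (xs : List A) {φ ψ} → (∀ a → φ a ≤ℚ ψ a) → Σₗ xs φ ≤ℚ Σₗ xs ψ
Σₗ-mono []       h = ℚₚ.≤-refl
Σₗ-mono (x ∷ xs) h = ℚₚ.+-mono-≤ (h x) (Σₗ-mono xs h)

Σₗ-+ : ∀ (xs : List A) φ ψ → Σₗ xs (λ a → φ a + ψ a) ≡ Σₗ xs φ + Σₗ xs ψ
Σₗ-+ []       φ ψ = refl
Σₗ-+ (x ∷ xs) φ ψ = trans (cong ((φ x + ψ x) +_) (Σₗ-+ xs φ ψ)) (rearrange (φ x) (ψ x) _ _)
  where
  rearrange : ∀ a b c d → a + b + (c + d) ≡ a + c + (b + d)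
  rearrange = solve-∀ ℚ-ring

Σₗ-*ʳ : ∀ (xs : List A) φ r → Σₗ xs (λ a → φ a * r) ≡ Σₗ xs φ * r
Σₗ-*ʳ []       φ r = sym (ℚₚ.*-zeroˡ r)
Σₗ-*ʳ (x ∷ xs) φ r = trans (cong (φ x * r +_) (Σₗ-*ʳ xs φ r)) (sym (ℚₚ.*-distribʳ-+ r (φ x) _))

Σₗ-cong : ∀ (xs : List A) {φ ψ} → (∀ a → φ a ≡ ψ a) → Σₗ xs φ ≡ Σₗ xs ψ
Σₗ-cong xs h = cong sumList (Listₚ.map-cong h xs)

Σₗ-++ : ∀ (xs ys : List A) φ → Σₗ (xs ++ ys) φ ≡ Σₗ xs φ + Σₗ ys φ
Σₗ-++ []       ys φ = sym (ℚₚ.+-identityˡ _)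
Σₗ-++ (x ∷ xs) ys φ = trans (cong (φ x +_) (Σₗ-++ xs ys φ)) (sym (ℚₚ.+-assoc (φ x) _ _))

Σₗ-concatMap : ∀ {C : Set} (g : A → B → C) xs ys φ →
  Σₗ (concatMap (λ a → List.map (g a) ys) xs) φ ≡ Σₗ xs (λ a → Σₗ ys (λ b → φ (g a b)))
Σₗ-concatMap g []       ys φ = refl
Σₗ-concatMap g (x ∷ xs) ys φ = trans (Σₗ-++ (List.map (g x) ys) _ φ)
  (cong₂ _+_ (cong sumList (sym (Listₚ.map-∘ ys))) (Σₗ-concatMap g xs ys φ))

length-concatMap : ∀ {C : Set} (g : A → B → C) xs ys →
  length (concatMap (λ a → List.map (g a) ys) xs) ≡ length xs ℕ.* length ys
length-concatMap g []       ys = refl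
length-concatMap g (x ∷ xs) ys = trans (Listₚ.length-++ (List.map (g x) ys))
  (cong₂ ℕ._+_ (Listₚ.length-map (g x) ys) (length-concatMap g xs ys))

-- A zero mean on the empty list keeps all the laws below, except that constants
-- only satisfy 𝔼 c ≤ c for c ≥ 0.
𝔼 : List A → (A → ℚ) → ℚ
𝔼 xs φ = mean (List.map φ xs)

𝔼≡ : ∀ (xs : List A) φ → 𝔼 xs φ ≡ Σₗ xs φ * recip (length xs)
𝔼≡ []       φ = refl
𝔼≡ (x ∷ xs) φ = cong (λ k → Σₗ (x ∷ xs) φ * recip (suc k)) (Listₚ.length-map φ xs)

𝔼-mono : ∀ (xs : List A) {φ ψ} → (∀ a → φ a ≤ℚ ψ a) → 𝔼 xs φ ≤ℚ 𝔼 xs ψ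
𝔼-mono xs {φ} {ψ} h = subst₂ _≤ℚ_ (sym (𝔼≡ xs φ)) (sym (𝔼≡ xs ψ))
  (*-monoʳ (recip (length xs)) (0≤recip (length xs)) (Σₗ-mono xs h))

𝔼-cong : ∀ (xs : List A) {φ ψ} → (∀ a → φ a ≡ ψ a) → 𝔼 xs φ ≡ 𝔼 xs ψ
𝔼-cong xs h = cong mean (Listₚ.map-cong h xs)

𝔼-+ : ∀ (xs : List A) φ ψ → 𝔼 xs (λ a → φ a + ψ a) ≡ 𝔼 xs φ + 𝔼 xs ψ
𝔼-+ xs φ ψ = begin
  𝔼 xs (λ a → φ a + ψ a)          ≡⟨ 𝔼≡ xs _ ⟩
  Σₗ xs (λ a → φ a + ψ a) * c     ≡⟨ cong (_* c) (Σₗ-+ xs φ ψ) ⟩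
  (Σₗ xs φ + Σₗ xs ψ) * c         ≡⟨ ℚₚ.*-distribʳ-+ c (Σₗ xs φ) (Σₗ xs ψ) ⟩
  Σₗ xs φ * c + Σₗ xs ψ * c       ≡⟨ cong₂ _+_ (𝔼≡ xs φ) (𝔼≡ xs ψ) ⟨
  𝔼 xs φ + 𝔼 xs ψ                 ∎
  where
  open ≡-Reasoning
  c = recip (length xs)

𝔼-*ʳ : ∀ (xs : List A) φ r → 𝔼 xs (λ a → φ a * r) ≡ 𝔼 xs φ * r
𝔼-*ʳ xs φ r = begin
  𝔼 xs (λ a → φ a * r)      ≡⟨ 𝔼≡ xs _ ⟩
  Σₗ xs (λ a → φ a * r) * c ≡⟨ cong (_* c) (Σₗ-*ʳ xs φ r) ⟩
  Σₗ xs φ * r * c           ≡⟨ rearrange (Σₗ xs φ) r c ⟩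
  Σₗ xs φ * c * r           ≡⟨ cong (_* r) (𝔼≡ xs φ) ⟨
  𝔼 xs φ * r                ∎
  where
  open ≡-Reasoning
  c = recip (length xs)
  rearrange : ∀ a b c → a * b * c ≡ a * c * b
  rearrange = solve-∀ ℚ-ring

𝔼-*ˡ : ∀ (xs : List A) φ r → 𝔼 xs (λ a → r * φ a) ≡ r * 𝔼 xs φ
𝔼-*ˡ xs φ r = trans (𝔼-cong xs (λ a → ℚₚ.*-comm r (φ a))) (trans (𝔼-*ʳ xs φ r) (ℚₚ.*-comm _ r))

𝔼-0 : ∀ (xs : List A) → 𝔼 xs (λ _ → 0ℚ) ≡ 0ℚ
𝔼-0 xs = trans (𝔼-*ʳ xs (λ _ → 0ℚ) 0ℚ) (ℚₚ.*-zeroʳ (𝔼 xs (λ _ → 0ℚ)))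

𝔼-nonneg : ∀ (xs : List A) {φ} → (∀ a → 0ℚ ≤ℚ φ a) → 0ℚ ≤ℚ 𝔼 xs φ
𝔼-nonneg xs {φ} h = subst (_≤ℚ 𝔼 xs φ) (𝔼-0 xs) (𝔼-mono xs h)

Σₗ-const : ∀ (xs : List A) r → Σₗ xs (λ _ → r) ≡ ℕ→ℚ (length xs) * r
Σₗ-const []       r = sym (ℚₚ.*-zeroˡ r)
Σₗ-const (x ∷ xs) r = begin
  r + Σₗ xs (λ _ → r)             ≡⟨ cong (r +_) (Σₗ-const xs r) ⟩
  r + ℕ→ℚ (length xs) * r         ≡⟨ rearrange r (ℕ→ℚ (length xs)) ⟩
  (1ℚ + ℕ→ℚ (length xs)) * r      ≡⟨ cong (_* r) (ℕ→ℚ-+ 1 (length xs)) ⟨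
  ℕ→ℚ (suc (length xs)) * r       ∎
  where
  open ≡-Reasoning
  rearrange : ∀ r n → r + n * r ≡ (1ℚ + n) * r
  rearrange = solve-∀ ℚ-ring

𝔼-const≤ : ∀ (xs : List A) {r} → 0ℚ ≤ℚ r → 𝔼 xs (λ _ → r) ≤ℚ r
𝔼-const≤ []           0≤r = 0≤r
𝔼-const≤ xs@(_ ∷ ys) {r} 0≤r = ℚₚ.≤-reflexive (begin
  𝔼 xs (λ _ → r)                  ≡⟨ 𝔼≡ xs (λ _ → r) ⟩
  Σₗ xs (λ _ → r) * c             ≡⟨ cong (_* c) (Σₗ-const xs r) ⟩
  ℕ→ℚ (length xs) * r * c         ≡⟨ rearrange (ℕ→ℚ (length xs)) r c ⟩
  c * ℕ→ℚ (length xs) * r         ≡⟨ cong (_* r) (1/*n≡1 (length ys)) ⟩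
  1ℚ * r                          ≡⟨ ℚₚ.*-identityˡ r ⟩
  r                               ∎)
  where
  open ≡-Reasoning
  c = recip (length xs)
  rearrange : ∀ a b c → a * b * c ≡ c * a * b
  rearrange = solve-∀ ℚ-ring

𝔼-concatMap : ∀ {C : Set} (g : A → B → C) xs ys φ →
  𝔼 (concatMap (λ a → List.map (g a) ys) xs) φ ≡ 𝔼 xs (λ a → 𝔼 ys (λ b → φ (g a b)))
𝔼-concatMap g xs ys φ = begin
  𝔼 zs φ
    ≡⟨ 𝔼≡ zs φ ⟩
  Σₗ zs φ * recip (length zs)
    ≡⟨ cong₂ _*_ (Σₗ-concatMap g xs ys φ) (trans (cong recip (length-concatMap g xs ys)) (recip-* (length xs) _)) ⟩
  Σₗ xs (λ a → Σₗ ys (φ ∘ g a)) * (c * d)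
    ≡⟨ rearrange (Σₗ xs (λ a → Σₗ ys (φ ∘ g a))) c d ⟩
  Σₗ xs (λ a → Σₗ ys (φ ∘ g a)) * d * c
    ≡⟨ cong (_* c) (Σₗ-*ʳ xs _ d) ⟨
  Σₗ xs (λ a → Σₗ ys (φ ∘ g a) * d) * c
    ≡⟨ cong (_* c) (Σₗ-cong xs (λ a → sym (𝔼≡ ys (φ ∘ g a)))) ⟩
  Σₗ xs (λ a → 𝔼 ys (φ ∘ g a)) * c
    ≡⟨ 𝔼≡ xs _ ⟨
  𝔼 xs (λ a → 𝔼 ys (φ ∘ g a)) ∎
  where
  open ≡-Reasoning
  zs = concatMap (λ a → List.map (g a) ys) xs
  c = recip (length xs)
  d = recip (length ys)
  rearrange : ∀ a b c → a * (b * c) ≡ a * c * b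
  rearrange = solve-∀ ℚ-ring

𝔼-⊗ : ∀ (xs : List A) (ys : List B) φ → 𝔼 (xs ⊗ ys) φ ≡ 𝔼 xs (λ a → 𝔼 ys (λ b → φ (a , b)))
𝔼-⊗ = 𝔼-concatMap _,_

𝔼-sumFin : ∀ (xs : List A) n (φ : Fin n → A → ℚ) →
  𝔼 xs (λ a → sumFin n (λ j → φ j a)) ≡ sumFin n (λ j → 𝔼 xs (φ j))
𝔼-sumFin xs zero    φ = 𝔼-0 xs
𝔼-sumFin xs (suc n) φ = trans (𝔼-+ xs (φ Fin.zero) _) (cong (𝔼 xs (φ Fin.zero) +_) (𝔼-sumFin xs n (φ ∘ Fin.suc)))

-- Finite sums over coordinates

sumFin-mono : ∀ n {g g′ : Fin n → ℚ} → (∀ j → g j ≤ℚ g′ j) → sumFin n g ≤ℚ sumFin n g′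
sumFin-mono zero    h = ℚₚ.≤-refl
sumFin-mono (suc n) h = ℚₚ.+-mono-≤ (h Fin.zero) (sumFin-mono n (h ∘ Fin.suc))

sumFin-cong : ∀ n {g g′ : Fin n → ℚ} → (∀ j → g j ≡ g′ j) → sumFin n g ≡ sumFin n g′
sumFin-cong zero    h = refl
sumFin-cong (suc n) h = cong₂ _+_ (h Fin.zero) (sumFin-cong n (h ∘ Fin.suc))

sumFin-+ : ∀ n (g g′ : Fin n → ℚ) → sumFin n (λ j → g j + g′ j) ≡ sumFin n g + sumFin n g′
sumFin-+ zero    g g′ = refl
sumFin-+ (suc n) g g′ = trans (cong ((g Fin.zero + g′ Fin.zero) +_) (sumFin-+ n (g ∘ Fin.suc) (g′ ∘ Fin.suc)))
  (rearrange (g Fin.zero) (g′ Fin.zero) _ _)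
  where
  rearrange : ∀ a b c d → a + b + (c + d) ≡ a + c + (b + d)
  rearrange = solve-∀ ℚ-ring

sumFin-*ˡ : ∀ n r (g : Fin n → ℚ) → sumFin n (λ j → r * g j) ≡ r * sumFin n g
sumFin-*ˡ zero    r g = sym (ℚₚ.*-zeroʳ r)
sumFin-*ˡ (suc n) r g = trans (cong (r * g Fin.zero +_) (sumFin-*ˡ n r (g ∘ Fin.suc)))
  (sym (ℚₚ.*-distribˡ-+ r (g Fin.zero) _))

sumFin-0 : ∀ n → sumFin n (λ _ → 0ℚ) ≡ 0ℚ
sumFin-0 zero    = refl
sumFin-0 (suc n) = cong (0ℚ +_) (sumFin-0 n)

sumFin-nonneg : ∀ n {g : Fin n → ℚ} → (∀ j → 0ℚ ≤ℚ g j) → 0ℚ ≤ℚ sumFin n g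
sumFin-nonneg n {g} h = subst (_≤ℚ sumFin n g) (sumFin-0 n) (sumFin-mono n h)

sumFin-selectˡ : ∀ n (i : Fin n) (g : Fin n → ℚ) →
  sumFin n (λ j → if does (j Fin.≟ i) then g j else 0ℚ) ≡ g i
sumFin-selectˡ (suc n) Fin.zero    g = trans (cong (g Fin.zero +_) (sumFin-0 n)) (ℚₚ.+-identityʳ _)
sumFin-selectˡ (suc n) (Fin.suc i) g = trans (ℚₚ.+-identityˡ _) (sumFin-selectˡ n i (g ∘ Fin.suc))

sumFin-selectʳ : ∀ n (i : Fin n) (g : Fin n → ℚ) →
  sumFin n (λ j → if does (i Fin.≟ j) then g j else 0ℚ) ≡ g i
sumFin-selectʳ (suc n) Fin.zero    g = trans (cong (g Fin.zero +_) (sumFin-0 n)) (ℚₚ.+-identityʳ _)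
sumFin-selectʳ (suc n) (Fin.suc i) g = trans (ℚₚ.+-identityˡ _) (sumFin-selectʳ n i (g ∘ Fin.suc))

-- Second moment of a row

-- The functions listed by `allFns` are anonymous pattern lambdas. The integrand is therefore
-- compared through the pointwise equations for `g`, which takes the place of function
-- extensionality.
𝔼-allFns-suc≤ : ∀ {n} (xs : List A) (φ : (Fin (suc n) → A) → ℚ) (ψ : A → (Fin n → A) → ℚ) →
  (∀ a f g → g Fin.zero ≡ a → (∀ j → g (Fin.suc j) ≡ f j) → φ g ≤ℚ ψ a f) →
  𝔼 (allFns (suc n) xs) φ ≤ℚ 𝔼 xs (λ a → 𝔼 (allFns n xs) (ψ a))
𝔼-allFns-suc≤ {n = n} xs φ ψ h = ℚₚ.≤-trans
  (ℚₚ.≤-reflexive (𝔼-concatMap _ xs (allFns n xs) φ))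
  (𝔼-mono xs λ a → 𝔼-mono (allFns n xs) λ f → h a f _ refl λ _ → refl)

signs : List Bool
signs = true ∷ false ∷ []

-- The offset c is what the induction on n accumulates.
𝔼-signs-sq≤ : ∀ n c (a : Fin n → ℚ) →
  𝔼 (allFns n signs) (λ s → sq (c + sumFin n (λ j → sgn (s j) * a j))) ≤ℚ sq c + sumFin n (sq ∘ a)
𝔼-signs-sq≤ zero c a = ℚₚ.≤-trans (𝔼-const≤ (allFns 0 signs) (0≤sq (c + 0ℚ)))
  (ℚₚ.≤-reflexive (trans (cong sq (ℚₚ.+-identityʳ c)) (sym (ℚₚ.+-identityʳ (sq c)))))
𝔼-signs-sq≤ (suc n) c a = begin
  𝔼 (allFns (suc n) signs) (λ s → sq (c + sumFin (suc n) (λ j → sgn (s j) * a j)))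
    ≤⟨ 𝔼-allFns-suc≤ signs _ ψ (λ b s g g0 g+ → ℚₚ.≤-reflexive (cong sq
         (trans (cong₂ (λ x y → c + (sgn x * a₀ + y)) g0 (sumFin-cong n λ j → cong (λ x → sgn x * a′ j) (g+ j)))
                (sym (ℚₚ.+-assoc c _ _))))) ⟩
  𝔼 signs (λ b → 𝔼 (allFns n signs) (ψ b))
    ≤⟨ 𝔼-mono signs (λ b → 𝔼-signs-sq≤ n (c + sgn b * a₀) a′) ⟩
  𝔼 signs (λ b → sq (c + sgn b * a₀) + sumFin n (sq ∘ a′))
    -- Averaging over the sign of `a₀` cancels the cross term with the offset; this is where the
    -- independence of the signs enters.
    ≡⟨ parallelogram c a₀ (sumFin n (sq ∘ a′)) ⟩
  sq c + (sq a₀ + sumFin n (sq ∘ a′)) ∎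
  where
  open ℚₚ.≤-Reasoning
  a₀ = a Fin.zero
  a′ = a ∘ Fin.suc
  ψ : Bool → (Fin n → Bool) → ℚ
  ψ b s = sq (c + sgn b * a₀ + sumFin n (λ j → sgn (s j) * a′ j))
  parallelogram : ∀ c a x →
    ((c + 1ℚ * a) * (c + 1ℚ * a) + x + ((c + (ℚ.- 1ℚ) * a) * (c + (ℚ.- 1ℚ) * a) + x + 0ℚ)) * ½
    ≡ c * c + (a * a + x)
  parallelogram = solve-∀ ℚ-ring

𝔼-marginal≤ : ∀ {n} (xs : List A) (φ : A → ℚ) → (∀ a → 0ℚ ≤ℚ φ a) → (j : Fin n) →
  𝔼 (allFns n xs) (λ f → φ (f j)) ≤ℚ 𝔼 xs φ
𝔼-marginal≤ {n = suc n} xs φ 0≤φ Fin.zero = ℚₚ.≤-trans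
  (𝔼-allFns-suc≤ xs _ (λ a _ → φ a) λ a f g g0 g+ → ℚₚ.≤-reflexive (cong φ g0))
  (𝔼-mono xs λ a → 𝔼-const≤ (allFns n xs) (0≤φ a))
𝔼-marginal≤ {n = suc n} xs φ 0≤φ (Fin.suc j) = ℚₚ.≤-trans
  (𝔼-allFns-suc≤ xs _ (λ _ f → φ (f j)) λ a f g g0 g+ → ℚₚ.≤-reflexive (cong φ (g+ j)))
  (ℚₚ.≤-trans (𝔼-mono xs λ _ → 𝔼-marginal≤ xs φ 0≤φ j) (𝔼-const≤ xs (𝔼-nonneg xs 0≤φ)))

-- The recursion over coordinates fixes whichever of `i` and `j` comes first and averages over the
-- other, so `κ` has to bound both partial averages. Distinctness ensures that the two values are
-- chosen independently.
𝔼-pair-marginal≤ : ∀ {n} (xs : List A) (φ : A → A → ℚ) {κ} → (∀ a b → 0ℚ ≤ℚ φ a b) → 0ℚ ≤ℚ κ →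
  (∀ a → 𝔼 xs (φ a) ≤ℚ κ) → (∀ b → 𝔼 xs (λ a → φ a b) ≤ℚ κ) →
  (i j : Fin n) → i ≢ j → 𝔼 (allFns n xs) (λ f → φ (f i) (f j)) ≤ℚ κ
𝔼-pair-marginal≤ xs φ 0≤φ 0≤κ hˡ hʳ Fin.zero Fin.zero i≢j = contradiction refl i≢j
𝔼-pair-marginal≤ xs φ 0≤φ 0≤κ hˡ hʳ Fin.zero (Fin.suc j) i≢j = ℚₚ.≤-trans
  (𝔼-allFns-suc≤ xs _ (λ a f → φ a (f j)) λ a f g g0 g+ → ℚₚ.≤-reflexive (cong₂ φ g0 (g+ j)))
  (ℚₚ.≤-trans (𝔼-mono xs λ a → ℚₚ.≤-trans (𝔼-marginal≤ xs (φ a) (0≤φ a) j) (hˡ a)) (𝔼-const≤ xs 0≤κ))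
𝔼-pair-marginal≤ xs φ 0≤φ 0≤κ hˡ hʳ (Fin.suc i) Fin.zero i≢j = ℚₚ.≤-trans
  (𝔼-allFns-suc≤ xs _ (λ b f → φ (f i) b) λ b f g g0 g+ → ℚₚ.≤-reflexive (cong₂ φ (g+ i) g0))
  (ℚₚ.≤-trans (𝔼-mono xs λ b → ℚₚ.≤-trans (𝔼-marginal≤ xs (λ a → φ a b) (λ a → 0≤φ a b) i) (hʳ b)) (𝔼-const≤ xs 0≤κ))
𝔼-pair-marginal≤ xs φ 0≤φ 0≤κ hˡ hʳ (Fin.suc i) (Fin.suc j) i≢j = ℚₚ.≤-trans
  (𝔼-allFns-suc≤ xs _ (λ _ f → φ (f i) (f j)) λ a f g g0 g+ → ℚₚ.≤-reflexive (cong₂ φ (g+ i) (g+ j)))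
  (ℚₚ.≤-trans (𝔼-mono xs λ _ → 𝔼-pair-marginal≤ xs φ 0≤φ 0≤κ hˡ hʳ i j (i≢j ∘ cong Fin.suc)) (𝔼-const≤ xs 0≤κ))

Σₗ-tabulate : ∀ n (f : Fin n → A) φ → Σₗ (List.tabulate f) φ ≡ sumFin n (φ ∘ f)
Σₗ-tabulate zero    f φ = refl
Σₗ-tabulate (suc n) f φ = cong (φ (f Fin.zero) +_) (Σₗ-tabulate n (f ∘ Fin.suc) φ)

𝔼-allFin : ∀ w φ → 𝔼 (List.allFin w) φ ≡ sumFin w φ * recip w
𝔼-allFin w φ = trans (𝔼≡ (List.allFin w) φ)
  (cong₂ (λ x k → x * recip k) (Σₗ-tabulate w (λ b → b) φ) (Listₚ.length-tabulate {n = w} (λ b → b)))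

-- Whichever of the two hash values is fixed, exactly one of the `w` values of the other meets it.
collision≤ : ∀ {n} w (i j : Fin n) → j ≢ i → ∀ {r} → 0ℚ ≤ℚ r →
  𝔼 (allFns n (List.allFin w)) (λ h → if does (h j Fin.≟ h i) then r else 0ℚ) ≤ℚ r * recip w
collision≤ w i j j≢i {r} 0≤r = 𝔼-pair-marginal≤ (List.allFin w)
  (λ a b → if does (a Fin.≟ b) then r else 0ℚ)
  (λ a b → indicator-nonneg (does (a Fin.≟ b)))
  (0≤* 0≤r (0≤recip w))
  (λ a → ℚₚ.≤-reflexive (trans (𝔼-allFin w _) (cong (_* recip w) (sumFin-selectʳ w a (λ _ → r)))))
  (λ b → ℚₚ.≤-reflexive (trans (𝔼-allFin w _) (cong (_* recip w) (sumFin-selectˡ w b (λ _ → r)))))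
  j i j≢i
  where
  indicator-nonneg : ∀ c → 0ℚ ≤ℚ (if c then r else 0ℚ)
  indicator-nonneg true  = 0≤r
  indicator-nonneg false = ℚₚ.≤-refl

-- Up to a global sign, the error of a row at i is the signed sum of these.
colliding : ∀ {n w} → (Fin n → Fin w) → (Fin n → ℚ) → Fin n → Fin n → ℚ
colliding h g i j = if does (j Fin.≟ i) then 0ℚ else (if does (h j Fin.≟ h i) then g j else 0ℚ)

rowEstimate-split : ∀ {n w} (h : Fin n → Fin w) (s : Fin n → Bool) (g : Fin n → ℚ) i →
  sumFin n (λ j → if does (h j Fin.≟ h i) then sgn (s j) * g j else 0ℚ)
  ≡ sgn (s i) * g i + sumFin n (λ j → sgn (s j) * colliding h g i j)
rowEstimate-split {n} h s g i = begin
  sumFin n (λ j → if does (h j Fin.≟ h i) then sgn (s j) * g j else 0ℚ)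
    ≡⟨ sumFin-cong n term ⟩
  sumFin n (λ j → (if does (j Fin.≟ i) then sgn (s j) * g j else 0ℚ) + sgn (s j) * colliding h g i j)
    ≡⟨ sumFin-+ n _ _ ⟩
  sumFin n (λ j → if does (j Fin.≟ i) then sgn (s j) * g j else 0ℚ) + sumFin n (λ j → sgn (s j) * colliding h g i j)
    ≡⟨ cong (_+ sumFin n (λ j → sgn (s j) * colliding h g i j)) (sumFin-selectˡ n i (λ j → sgn (s j) * g j)) ⟩
  sgn (s i) * g i + sumFin n (λ j → sgn (s j) * colliding h g i j) ∎
  where
  open ≡-Reasoning
  term : ∀ j → (if does (h j Fin.≟ h i) then sgn (s j) * g j else 0ℚ)
             ≡ (if does (j Fin.≟ i) then sgn (s j) * g j else 0ℚ) + sgn (s j) * colliding h g i j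
  term j with j Fin.≟ i
  term j | yes refl rewrite dec-true (h j Fin.≟ h j) refl =
    sym (trans (cong (sgn (s j) * g j +_) (ℚₚ.*-zeroʳ (sgn (s j)))) (ℚₚ.+-identityʳ _))
  term j | no _ with does (h j Fin.≟ h i)
  ... | true  = sym (ℚₚ.+-identityˡ _)
  ... | false = sym (trans (ℚₚ.+-identityˡ _) (ℚₚ.*-zeroʳ (sgn (s j))))

sq-sgn : ∀ b → sq (sgn b) ≡ 1ℚ
sq-sgn true  = refl
sq-sgn false = refl

-- The coordinate `i` always collides with itself, and since the square of its sign is 1 this term
-- cancels against `g i`; the global sign disappears on squaring. The leading `0ℚ` is the initial
-- offset for `𝔼-signs-sq≤`.
rowError-sq : ∀ {n w} (h : Fin n → Fin w) (s : Fin n → Bool) (g : Fin n → ℚ) i →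
  sq (rowEstimate (h , s) g i - g i) ≡ sq (0ℚ + sumFin n (λ j → sgn (s j) * colliding h g i j))
rowError-sq {n} h s g i = begin
  sq (σ * sumFin n (λ j → if does (h j Fin.≟ h i) then sgn (s j) * g j else 0ℚ) - g i)
    ≡⟨ cong (λ x → sq (σ * x - g i)) (rowEstimate-split h s g i) ⟩
  sq (σ * (σ * g i + y) - g i)
    ≡⟨ cong sq (expand σ (g i) y) ⟩
  sq ((σ * σ) * g i + σ * y - g i)
    ≡⟨ cong (λ x → sq (x * g i + σ * y - g i)) (sq-sgn (s i)) ⟩
  sq (1ℚ * g i + σ * y - g i)
    ≡⟨ square σ (g i) y ⟩
  (σ * σ) * sq y
    ≡⟨ cong (_* sq y) (sq-sgn (s i)) ⟩
  1ℚ * sq y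
    ≡⟨ unit y ⟩
  sq (0ℚ + y) ∎
  where
  open ≡-Reasoning
  σ = sgn (s i)
  y = sumFin n (λ j → sgn (s j) * colliding h g i j)
  expand : ∀ σ v y → σ * (σ * v + y) - v ≡ (σ * σ) * v + σ * y - v
  expand = solve-∀ ℚ-ring
  square : ∀ σ v y → (1ℚ * v + σ * y - v) * (1ℚ * v + σ * y - v) ≡ (σ * σ) * (y * y)
  square = solve-∀ ℚ-ring
  unit : ∀ y → 1ℚ * (y * y) ≡ (0ℚ + y) * (0ℚ + y)
  unit = solve-∀ ℚ-ring

-- Averaging over the signs first, with the hash function fixed, leaves a sum of squares without
-- cross terms. The hash average then involves one pair of coordinates at a time.
𝔼-rowError-sq≤ : ∀ n w (g : Fin n → ℚ) i →
  𝔼 (allRows n w) (λ r → sq (rowEstimate r g i - g i)) ≤ℚ recip w * sumFin n (sq ∘ g)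
𝔼-rowError-sq≤ n w g i = begin
  𝔼 (allRows n w) (λ r → sq (rowEstimate r g i - g i))
    ≡⟨ 𝔼-⊗ hashes (allFns n signs) _ ⟩
  𝔼 hashes (λ h → 𝔼 (allFns n signs) (λ s → sq (rowEstimate (h , s) g i - g i)))
    ≡⟨ 𝔼-cong hashes (λ h → 𝔼-cong (allFns n signs) (λ s → rowError-sq h s g i)) ⟩
  𝔼 hashes (λ h → 𝔼 (allFns n signs) (λ s → sq (0ℚ + sumFin n (λ j → sgn (s j) * colliding h g i j))))
    ≤⟨ 𝔼-mono hashes (λ h → 𝔼-signs-sq≤ n 0ℚ (colliding h g i)) ⟩
  𝔼 hashes (λ h → sq 0ℚ + sumFin n (sq ∘ colliding h g i))
    ≡⟨ 𝔼-cong hashes (λ h → ℚₚ.+-identityˡ _) ⟩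
  𝔼 hashes (λ h → sumFin n (λ j → sq (colliding h g i j)))
    ≡⟨ 𝔼-sumFin hashes n (λ j h → sq (colliding h g i j)) ⟩
  sumFin n (λ j → 𝔼 hashes (λ h → sq (colliding h g i j)))
    ≤⟨ sumFin-mono n term ⟩
  sumFin n (λ j → recip w * sq (g j))
    ≡⟨ sumFin-*ˡ n (recip w) (sq ∘ g) ⟩
  recip w * sumFin n (sq ∘ g) ∎
  where
  open ℚₚ.≤-Reasoning
  hashes = allFns n (List.allFin w)
  sq-if : ∀ c x → sq (if c then x else 0ℚ) ≡ (if c then sq x else 0ℚ)
  sq-if true  x = refl
  sq-if false x = refl
  term : ∀ j → 𝔼 hashes (λ h → sq (colliding h g i j)) ≤ℚ recip w * sq (g j)
  term j with j Fin.≟ i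
  ... | yes _  = subst (_≤ℚ recip w * sq (g j)) (sym (𝔼-0 hashes)) (0≤* (0≤recip w) (0≤sq (g j)))
  ... | no j≢i = subst₂ _≤ℚ_ (𝔼-cong hashes (λ h → sym (sq-if (does (h j Fin.≟ h i)) (g j))))
                   (ℚₚ.*-comm (sq (g j)) (recip w)) (collision≤ w i j j≢i (0≤sq (g j)))

-- Medians and products over tables

prodList : List ℚ → ℚ
prodList = List.foldr _*_ 1ℚ

prodList-↭ : ∀ {xs ys} → xs ↭ ys → prodList xs ≡ prodList ys
prodList-↭ ↭.refl          = refl
prodList-↭ (↭.prep x p)    = cong (x *_) (prodList-↭ p)
prodList-↭ (↭.swap {xs} {ys} x y p) =
  trans (cong (λ z → x * (y * z)) (prodList-↭ p)) (exchange x y (prodList ys))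
  where
  exchange : ∀ x y z → x * (y * z) ≡ y * (x * z)
  exchange = solve-∀ ℚ-ring
prodList-↭ (↭.trans p q)   = trans (prodList-↭ p) (prodList-↭ q)

nth-∈ : ∀ ys k → k < length ys → nth ys k ∈ ys
nth-∈ (y ∷ ys) zero    _       = here refl
nth-∈ (y ∷ ys) (suc k) (s≤s p) = there (nth-∈ ys k p)

-- With three entries nothing is averaged: the median computes to entry 1 of the sorted list, hence
-- is one of the three, and its value under `ψ` is a summand on the right.
median-of-3≤ : ∀ (ψ : ℚ → ℚ) → (∀ x → 0ℚ ≤ℚ ψ x) → ∀ x y z →
  ψ (median (x ∷ y ∷ z ∷ [])) ≤ℚ sumList (ψ x ∷ ψ y ∷ ψ z ∷ [])
median-of-3≤ ψ 0≤ψ x y z = bound (↭ₚ.∈-resp-↭ (sort-↭ xs) (nth-∈ (sort xs) 1 1<length))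
  where
  xs = x ∷ y ∷ z ∷ []
  1<length : 1 < length (sort xs)
  1<length = subst (1 <_) (sym (↭ₚ.↭-length (sort-↭ xs))) (s≤s (s≤s z≤n))
  ≤+ʳ : ∀ {p q} → 0ℚ ≤ℚ q → p ≤ℚ p + q
  ≤+ʳ {p} 0≤q = subst (_≤ℚ p + _) (ℚₚ.+-identityʳ p) (ℚₚ.+-monoʳ-≤ p 0≤q)
  ≤+ˡ : ∀ {p q} → 0ℚ ≤ℚ p → q ≤ℚ p + q
  ≤+ˡ {p} {q} 0≤p = subst (_≤ℚ p + q) (ℚₚ.+-identityˡ q) (ℚₚ.+-monoˡ-≤ q 0≤p)
  0≤z : 0ℚ ≤ℚ ψ z + 0ℚ
  0≤z = 0≤+ (0≤ψ z) ℚₚ.≤-refl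
  bound : ∀ {m} → m ∈ xs → ψ m ≤ℚ sumList (ψ x ∷ ψ y ∷ ψ z ∷ [])
  bound (here refl)                 = ≤+ʳ (0≤+ (0≤ψ y) 0≤z)
  bound (there (here refl))         = ℚₚ.≤-trans (≤+ʳ 0≤z) (≤+ˡ (0≤ψ x))
  bound (there (there (here refl))) =
    ℚₚ.≤-trans (≤+ʳ ℚₚ.≤-refl) (ℚₚ.≤-trans (≤+ˡ (0≤ψ y)) (≤+ˡ (0≤ψ x)))

k+suc-k : ∀ k → k ℕ.+ suc k ≡ 1 ℕ.+ k ℕ.* 2
k+suc-k = ℕ-solve-∀

odd/2 : ∀ k → (k ℕ.+ suc k) ℕ./ 2 ≡ k
odd/2 k = begin
  (k ℕ.+ suc k) ℕ./ 2     ≡⟨ cong (ℕ._/ 2) (k+suc-k k) ⟩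
  (1 ℕ.+ k ℕ.* 2) ℕ./ 2   ≡⟨ ℕₘ.+-distrib-/-∣ʳ 1 {k ℕ.* 2} {2} (ℕ∣.divides k refl) ⟩
  k ℕ.* 2 ℕ./ 2           ≡⟨ ℕₘ.m*n/n≡m k 2 ⟩
  k                       ∎
  where open ≡-Reasoning

odd%2 : ∀ k → (k ℕ.+ suc k) ℕ.% 2 ≡ 1
odd%2 k = trans (cong (ℕ._% 2) (k+suc-k k)) (ℕₘ.[m+kn]%n≡m%n 1 k 2)

median-odd : ∀ xs k → length xs ≡ k ℕ.+ suc k → median xs ≡ nth (sort xs) k
median-odd xs k eq with sort xs | length xs
median-odd xs k refl | ys | .(k ℕ.+ suc k) rewrite odd%2 k | odd/2 k = refl

module Majority (ψ : ℚ → ℚ) (τ : ℚ)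
  (¼≤ψ : ∀ x → ℤ.+ 1 / 4 ≤ℚ ψ x) (4≤ψ : ∀ x → τ ≤ℚ x → ℕ→ℚ 4 ≤ℚ ψ x) where

  0≤ψ : ∀ x → 0ℚ ≤ℚ ψ x
  0≤ψ x = ℚₚ.≤-trans (≤-numeral 0ℚ (ℤ.+ 1 / 4)) (¼≤ψ x)

  above : ∀ {y ys} → Sorted (y ∷ ys) → τ ≤ℚ y → ℕ→ℚ (4 ℕ.^ length (y ∷ ys)) ≤ℚ prodList (List.map ψ (y ∷ ys))
  above {y} {[]} _ τ≤y = subst (ℕ→ℚ 4 ≤ℚ_) (sym (ℚₚ.*-identityʳ (ψ y))) (4≤ψ y τ≤y)
  above {y} {z ∷ zs} (y≤z Linked.∷ s) τ≤y = subst (_≤ℚ ψ y * prodList (List.map ψ (z ∷ zs)))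
    (sym (ℕ→ℚ-* 4 (4 ℕ.^ length (z ∷ zs))))
    (*-mono (0≤ψ y) (0≤ℕ→ℚ (4 ℕ.^ length (z ∷ zs))) (4≤ψ y τ≤y) (above s (ℚₚ.≤-trans τ≤y y≤z)))

  -- Each of the `k` smallest entries is worth at least 1/4. Moving these factors to the other side
  -- as a power of 4 lets the induction skip one entry at a time without division.
  from : ∀ ys k d → Sorted ys → length ys ≡ k ℕ.+ d → τ ≤ℚ nth ys k →
    ℕ→ℚ (4 ℕ.^ d) ≤ℚ ℕ→ℚ (4 ℕ.^ k) * prodList (List.map ψ ys)
  from []       zero    .zero    s refl h = ≤-numeral (ℕ→ℚ 1) (ℕ→ℚ 1 * 1ℚ)
  from (y ∷ ys) zero    .(suc (length ys)) s refl h =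
    subst (ℕ→ℚ (4 ℕ.^ suc (length ys)) ≤ℚ_) (sym (ℚₚ.*-identityˡ _)) (above s h)
  from (y ∷ ys) (suc k) d s eq h = begin
    ℕ→ℚ (4 ℕ.^ d)
      ≤⟨ from ys k d (Linked.tail s) (ℕₚ.suc-injective eq) h ⟩
    ℕ→ℚ (4 ℕ.^ k) * p
      ≡⟨ ℚₚ.*-identityˡ _ ⟨
    1ℚ * (ℕ→ℚ (4 ℕ.^ k) * p)
      ≤⟨ *-monoʳ (ℕ→ℚ (4 ℕ.^ k) * p) (0≤* (0≤ℕ→ℚ (4 ℕ.^ k)) 0≤p) (*-monoˡ (ℕ→ℚ 4) (0≤ℕ→ℚ 4) (¼≤ψ y)) ⟩
    (ℕ→ℚ 4 * ψ y) * (ℕ→ℚ (4 ℕ.^ k) * p)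
      ≡⟨ rearrange (ℕ→ℚ 4) (ψ y) (ℕ→ℚ (4 ℕ.^ k)) p ⟩
    (ℕ→ℚ 4 * ℕ→ℚ (4 ℕ.^ k)) * (ψ y * p)
      ≡⟨ cong (_* (ψ y * p)) (ℕ→ℚ-* 4 (4 ℕ.^ k)) ⟨
    ℕ→ℚ (4 ℕ.^ suc k) * (ψ y * p) ∎
    where
    open ℚₚ.≤-Reasoning
    p = prodList (List.map ψ ys)
    prod-nonneg : ∀ zs → 0ℚ ≤ℚ prodList (List.map ψ zs)
    prod-nonneg []       = ≤-numeral 0ℚ 1ℚ
    prod-nonneg (z ∷ zs) = 0≤* (0≤ψ z) (prod-nonneg zs)
    0≤p = prod-nonneg ys
    rearrange : ∀ a b c d → (a * b) * (c * d) ≡ (a * c) * (b * d)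
    rearrange = solve-∀ ℚ-ring

  -- If the median reaches τ then at least half of the entries do, and each pays for one that does not.
  1≤prod : ∀ xs k → length xs ≡ k ℕ.+ suc k → τ ≤ℚ median xs → 1ℚ ≤ℚ prodList (List.map ψ xs)
  1≤prod xs k len h = *-cancelʳ c 0<c (begin
    1ℚ * c                              ≡⟨ ℚₚ.*-identityˡ c ⟩
    -- In the sorted list `k` entries precede the median and `suc k` begin with it; the surplus
    -- factor 4 is given away.
    c                                   ≤⟨ ℕ→ℚ-mono (ℕₚ.^-monoʳ-≤ 4 (ℕₚ.n≤1+n k)) ⟩
    ℕ→ℚ (4 ℕ.^ suc k)                   ≤⟨ from (sort xs) k (suc k) (sort-↗ xs)
                                              (trans (↭ₚ.↭-length (sort-↭ xs)) len)
                                              (subst (τ ≤ℚ_) (median-odd xs k len) h) ⟩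
    c * prodList (List.map ψ (sort xs)) ≡⟨ cong (c *_) (prodList-↭ (↭ₚ.map⁺ ψ (sort-↭ xs))) ⟩
    c * prodList (List.map ψ xs)        ≡⟨ ℚₚ.*-comm c _ ⟩
    prodList (List.map ψ xs) * c        ∎)
    where
    open ℚₚ.≤-Reasoning
    c = ℕ→ℚ (4 ℕ.^ k)
    0<c : 0ℚ <ℚ c
    0<c = ℚₚ.<-≤-trans (0<ℕ→ℚ 0) (ℕ→ℚ-mono (ℕₚ.m^n>0 4 k))

-- Sums and products over independent tables

overVec : ∀ {m} → (A → ℚ) → Vec A m → List ℚ
overVec φ v = Vec.toList (Vec.map φ v)

map-overVec : ∀ {m} (ψ : ℚ → ℚ) (φ : A → ℚ) (v : Vec A m) → List.map ψ (overVec φ v) ≡ overVec (ψ ∘ φ) v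
map-overVec ψ φ Vec.[]      = refl
map-overVec ψ φ (a Vec.∷ v) = cong (ψ (φ a) ∷_) (map-overVec ψ φ v)

prodList-overVec-nonneg : ∀ {m} (φ : A → ℚ) → (∀ a → 0ℚ ≤ℚ φ a) → (v : Vec A m) → 0ℚ ≤ℚ prodList (overVec φ v)
prodList-overVec-nonneg φ 0≤φ Vec.[]      = ≤-numeral 0ℚ 1ℚ
prodList-overVec-nonneg φ 0≤φ (a Vec.∷ v) = 0≤* (0≤φ a) (prodList-overVec-nonneg φ 0≤φ v)

𝔼-allVecs-sum≤ : ∀ m (xs : List A) φ → (∀ a → 0ℚ ≤ℚ φ a) →
  𝔼 (allVecs m xs) (λ v → sumList (overVec φ v)) ≤ℚ ℕ→ℚ m * 𝔼 xs φ
𝔼-allVecs-sum≤ zero    xs φ 0≤φ = ℚₚ.≤-reflexive (sym (ℚₚ.*-zeroˡ (𝔼 xs φ)))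
𝔼-allVecs-sum≤ (suc m) xs φ 0≤φ = begin
  𝔼 (allVecs (suc m) xs) (λ v → sumList (overVec φ v))
    ≡⟨ 𝔼-concatMap Vec._∷_ xs vs _ ⟩
  𝔼 xs (λ a → 𝔼 vs (λ v → φ a + sumList (overVec φ v)))
    ≡⟨ 𝔼-cong xs (λ a → 𝔼-+ vs (λ _ → φ a) _) ⟩
  𝔼 xs (λ a → 𝔼 vs (λ _ → φ a) + 𝔼 vs (λ v → sumList (overVec φ v)))
    ≤⟨ 𝔼-mono xs (λ a → ℚₚ.+-mono-≤ (𝔼-const≤ vs (0≤φ a)) (𝔼-allVecs-sum≤ m xs φ 0≤φ)) ⟩
  𝔼 xs (λ a → φ a + ℕ→ℚ m * 𝔼 xs φ)
    ≡⟨ 𝔼-+ xs φ _ ⟩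
  𝔼 xs φ + 𝔼 xs (λ _ → ℕ→ℚ m * 𝔼 xs φ)
    ≤⟨ ℚₚ.+-monoʳ-≤ (𝔼 xs φ) (𝔼-const≤ xs (0≤* (0≤ℕ→ℚ m) (𝔼-nonneg xs 0≤φ))) ⟩
  𝔼 xs φ + ℕ→ℚ m * 𝔼 xs φ
    ≡⟨ rearrange (𝔼 xs φ) (ℕ→ℚ m) ⟩
  (1ℚ + ℕ→ℚ m) * 𝔼 xs φ
    ≡⟨ cong (_* 𝔼 xs φ) (ℕ→ℚ-+ 1 m) ⟨
  ℕ→ℚ (suc m) * 𝔼 xs φ ∎
  where
  open ℚₚ.≤-Reasoning
  vs = allVecs m xs
  rearrange : ∀ x m → x + m * x ≡ (1ℚ + m) * x
  rearrange = solve-∀ ℚ-ring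

-- Independence: components are averaged one after another, so the expected product factorises. The
-- bound has the form `recip k` so that its powers are again reciprocals of natural numbers.
𝔼-allVecs-prod≤ : ∀ m (xs : List A) φ k → (∀ a → 0ℚ ≤ℚ φ a) → 𝔼 xs φ ≤ℚ recip k →
  𝔼 (allVecs m xs) (λ v → prodList (overVec φ v)) ≤ℚ recip (k ℕ.^ m)
𝔼-allVecs-prod≤ zero    xs φ k 0≤φ h = ≤-numeral 1ℚ 1ℚ
𝔼-allVecs-prod≤ (suc m) xs φ k 0≤φ h = begin
  𝔼 (allVecs (suc m) xs) (λ v → prodList (overVec φ v))
    ≡⟨ 𝔼-concatMap Vec._∷_ xs vs _ ⟩
  𝔼 xs (λ a → 𝔼 vs (λ v → φ a * prodList (overVec φ v)))
    ≡⟨ 𝔼-cong xs (λ a → 𝔼-*ˡ vs _ (φ a)) ⟩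
  𝔼 xs (λ a → φ a * 𝔼 vs (λ v → prodList (overVec φ v)))
    ≡⟨ 𝔼-*ʳ xs φ _ ⟩
  𝔼 xs φ * 𝔼 vs (λ v → prodList (overVec φ v))
    ≤⟨ *-mono (0≤recip k) (𝔼-nonneg vs (prodList-overVec-nonneg φ 0≤φ)) h (𝔼-allVecs-prod≤ m xs φ k 0≤φ h) ⟩
  recip k * recip (k ℕ.^ m)
    ≡⟨ recip-* k (k ℕ.^ m) ⟨
  recip (k ℕ.^ suc m) ∎
  where
  open ℚₚ.≤-Reasoning
  vs = allVecs m xs

𝔼-tableError-sq≤ : ∀ n w (g : Fin n → ℚ) i →
  𝔼 (allTables n w) (λ t → sq (csEstimate t g i - g i)) ≤ℚ ℕ→ℚ 3 * (recip w * sumFin n (sq ∘ g))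
𝔼-tableError-sq≤ n w g i = begin
  𝔼 (allTables n w) (λ t → sq (csEstimate t g i - g i))
    ≤⟨ 𝔼-mono (allTables n w) (λ { (r Vec.∷ r′ Vec.∷ r″ Vec.∷ Vec.[]) →
         median-of-3≤ (λ x → sq (x - g i)) (λ x → 0≤sq (x - g i))
           (rowEstimate r g i) (rowEstimate r′ g i) (rowEstimate r″ g i) }) ⟩
  𝔼 (allTables n w) (λ t → sumList (overVec (λ r → sq (rowEstimate r g i - g i)) t))
    ≤⟨ 𝔼-allVecs-sum≤ 3 (allRows n w) _ (λ r → 0≤sq (rowEstimate r g i - g i)) ⟩
  ℕ→ℚ 3 * 𝔼 (allRows n w) (λ r → sq (rowEstimate r g i - g i))
    ≤⟨ *-monoˡ (ℕ→ℚ 3) (0≤ℕ→ℚ 3) (𝔼-rowError-sq≤ n w g i) ⟩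
  ℕ→ℚ 3 * (recip w * sumFin n (sq ∘ g)) ∎
  where open ℚₚ.≤-Reasoning

-- Logarithms, harmonic sums and the tail

recip*n≡1 : ∀ n → 0 < n → recip n * ℕ→ℚ n ≡ 1ℚ
recip*n≡1 (suc n) _ = 1/*n≡1 n

recip-scale : ∀ c m n → 0 < m → 0 < n → n ≤ c ℕ.* m → recip m ≤ℚ ℕ→ℚ c * recip n
recip-scale c m@(suc m′) n 0<m 0<n n≤cm = *-cancelʳ (ℕ→ℚ m) (0<ℕ→ℚ m′) (begin
  recip m * ℕ→ℚ m             ≡⟨ recip*n≡1 m 0<m ⟩
  1ℚ                          ≡⟨ recip*n≡1 n 0<n ⟨
  recip n * ℕ→ℚ n             ≤⟨ *-monoˡ (recip n) (0≤recip n) (ℕ→ℚ-mono n≤cm) ⟩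
  recip n * ℕ→ℚ (c ℕ.* m)     ≡⟨ cong (recip n *_) (ℕ→ℚ-* c m) ⟩
  recip n * (ℕ→ℚ c * ℕ→ℚ m)   ≡⟨ rearrange (recip n) (ℕ→ℚ c) (ℕ→ℚ m) ⟩
  ℕ→ℚ c * recip n * ℕ→ℚ m     ∎)
  where
  open ℚₚ.≤-Reasoning
  rearrange : ∀ a b c → a * (b * c) ≡ b * a * c
  rearrange = solve-∀ ℚ-ring

recip-anti : ∀ {m n} → 0 < m → m ≤ n → recip n ≤ℚ recip m
recip-anti {m} {n} 0<m m≤n = subst (recip n ≤ℚ_) (ℚₚ.*-identityˡ (recip m))
  (recip-scale 1 n m (ℕₚ.<-≤-trans 0<m m≤n) 0<m (subst (m ≤_) (sym (ℕₚ.*-identityˡ n)) m≤n))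

⊘-ℕ : ∀ p n → 0 < n → p ⊘ ℕ→ℚ n ≡ p * recip n
⊘-ℕ p n@(suc n′) 0<n = trans (⊘-as-* p (ℕ→ℚ n)) (cong (p *_) (begin
  1ℚ ⊘ ν                      ≡⟨ ℚₚ.*-identityʳ _ ⟨
  (1ℚ ⊘ ν) * 1ℚ               ≡⟨ cong ((1ℚ ⊘ ν) *_) (recip*n≡1 n 0<n) ⟨
  (1ℚ ⊘ ν) * (recip n * ν)    ≡⟨ rearrange (1ℚ ⊘ ν) (recip n) ν ⟩
  (1ℚ ⊘ ν) * ν * recip n      ≡⟨ cong (_* recip n) (⊘-inverse ν (0<ℕ→ℚ n′)) ⟩
  1ℚ * recip n                ≡⟨ ℚₚ.*-identityˡ (recip n) ⟩
  recip n                     ∎))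
  where
  open ≡-Reasoning
  ν = ℕ→ℚ n
  rearrange : ∀ a b c → a * (b * c) ≡ a * c * b
  rearrange = solve-∀ ℚ-ring

n<2^[1+lg] : ∀ n → n < 2 ℕ.^ suc (lg n)
n<2^[1+lg] n with 2 ℕ.^ suc (lg n) ℕₚ.≤? n
... | no  ≰n = ℕₚ.≰⇒> ≰n
... | yes ≤n = contradiction
  (ℕₚ.≤-trans (ℕₚ.≤-reflexive (sym (⌊log₂[2^n]⌋≡n (suc (lg n))))) (⌊log₂⌋-mono-≤ ≤n)) (ℕₚ.<-irrefl refl)

-- The recursion is on the value of the logarithm, which halving lowers by one, because half of `n`
-- is not a structural subterm of `n`.
2^lg≤n : ∀ n → 0 < n → 2 ℕ.^ lg n ≤ n
2^lg≤n n 0<n = go (lg n) n refl 0<n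
  where
  go : ∀ k n → lg n ≡ k → 0 < n → 2 ℕ.^ k ≤ n
  go zero    n eq 0<n = 0<n
  go (suc k) 1 () _
  go (suc k) n@(suc (suc _)) eq _ = ℕₚ.≤-trans
    (ℕₚ.*-monoʳ-≤ 2 (go k ℕ.⌊ n /2⌋ (trans (⌊log₂⌊n/2⌋⌋≡⌊log₂n⌋∸1 n) (cong (ℕ._∸ 1) eq)) (s≤s z≤n)))
    (ℕₚ.≤-trans (ℕₚ.≤-reflexive (cong (ℕ.⌊ n /2⌋ ℕ.+_) (ℕₚ.+-identityʳ ℕ.⌊ n /2⌋)))
      (ℕₚ.≤-trans (ℕₚ.+-monoʳ-≤ ℕ.⌊ n /2⌋ (ℕₚ.⌊n/2⌋≤⌈n/2⌉ n)) (ℕₚ.≤-reflexive (ℕₚ.⌊n/2⌋+⌈n/2⌉≡n n))))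

sumFin-const : ∀ n r → sumFin n (λ _ → r) ≡ ℕ→ℚ n * r
sumFin-const zero    r = sym (ℚₚ.*-zeroˡ r)
sumFin-const (suc n) r = trans (cong (r +_) (sumFin-const n r))
  (trans (rearrange r (ℕ→ℚ n)) (cong (_* r) (sym (ℕ→ℚ-+ 1 n))))
  where
  rearrange : ∀ r n → r + n * r ≡ (1ℚ + n) * r
  rearrange = solve-∀ ℚ-ring

sumFin-toℕ-+ : ∀ m d (v : ℕ → ℚ) → sumFin (m ℕ.+ d) (v ∘ toℕ) ≡ sumFin m (v ∘ toℕ) + sumFin d (λ j → v (m ℕ.+ toℕ j))
sumFin-toℕ-+ zero    d v = sym (ℚₚ.+-identityˡ _)
sumFin-toℕ-+ (suc m) d v = trans (cong (v 0 +_) (sumFin-toℕ-+ m d (v ∘ suc))) (sym (ℚₚ.+-assoc (v 0) _ _))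

-- Harmonic sums

0≤zipf : ∀ {n} (i : Fin n) → 0ℚ ≤ℚ zipf i
0≤zipf i = 0≤1/ (toℕ i)

totalMass-+ : ∀ m d → totalMass (m ℕ.+ d) ≡ totalMass m + sumFin d (λ j → recip (suc (m ℕ.+ toℕ j)))
totalMass-+ m d = sumFin-toℕ-+ m d (recip ∘ suc)

totalMass-mono : ∀ {m n} → m ≤ n → totalMass m ≤ℚ totalMass n
totalMass-mono {m} {n} m≤n = subst₂ _≤ℚ_ (ℚₚ.+-identityʳ _)
  (trans (sym (totalMass-+ m (n ℕ.∸ m))) (cong totalMass (ℕₚ.m+[n∸m]≡n m≤n)))
  (ℚₚ.+-monoʳ-≤ (totalMass m) (sumFin-nonneg (n ℕ.∸ m) (λ j → 0≤recip (suc (m ℕ.+ toℕ j)))))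

0<2^ : ∀ k → 0 < 2 ℕ.^ k
0<2^ k = ℕₚ.m^n>0 2 k

-- Dyadic blocks: the new block has 2^k terms, each between 1/2^(k+1) and 1/2^k, so every doubling
-- adds between 1/2 and 1 to the mass. Both logarithmic bounds on the mass come from this.
totalMass-doubling : ∀ k → totalMass (2 ℕ.^ suc k) ≡
  totalMass (2 ℕ.^ k) + sumFin (2 ℕ.^ k) (λ j → recip (suc (2 ℕ.^ k ℕ.+ toℕ j)))
totalMass-doubling k = trans (cong (λ x → totalMass (2 ℕ.^ k ℕ.+ x)) (ℕₚ.+-identityʳ (2 ℕ.^ k)))
  (totalMass-+ (2 ℕ.^ k) (2 ℕ.^ k))

totalMass-2^≤ : ∀ k → totalMass (2 ℕ.^ k) ≤ℚ ℕ→ℚ (suc k)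
totalMass-2^≤ zero    = ≤-numeral (totalMass 1) 1ℚ
totalMass-2^≤ (suc k) = begin
  totalMass (2 ℕ.^ suc k)
    ≡⟨ totalMass-doubling k ⟩
  totalMass d + sumFin d (λ j → recip (suc (d ℕ.+ toℕ j)))
    ≤⟨ ℚₚ.+-mono-≤ (totalMass-2^≤ k) (sumFin-mono d λ j →
         recip-anti (0<2^ k) (ℕₚ.m≤n⇒m≤1+n (ℕₚ.m≤m+n d (toℕ j)))) ⟩
  ℕ→ℚ (suc k) + sumFin d (λ _ → recip d)
    ≡⟨ cong (ℕ→ℚ (suc k) +_) (trans (sumFin-const d (recip d)) (trans (ℚₚ.*-comm (ℕ→ℚ d) _) (recip*n≡1 d (0<2^ k)))) ⟩
  ℕ→ℚ (suc k) + 1ℚ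
    ≡⟨ ℚₚ.+-comm (ℕ→ℚ (suc k)) 1ℚ ⟩
  1ℚ + ℕ→ℚ (suc k)
    ≡⟨ ℕ→ℚ-+ 1 (suc k) ⟨
  ℕ→ℚ (suc (suc k)) ∎
  where
  open ℚₚ.≤-Reasoning
  d = 2 ℕ.^ k

≤totalMass-2^ : ∀ k → ½ * ℕ→ℚ k ≤ℚ totalMass (2 ℕ.^ k)
≤totalMass-2^ zero    = ≤-numeral (½ * ℕ→ℚ 0) (totalMass 1)
≤totalMass-2^ (suc k) = begin
  ½ * ℕ→ℚ (suc k)
    ≡⟨ cong (½ *_) (ℕ→ℚ-+ 1 k) ⟩
  ½ * (1ℚ + ℕ→ℚ k)
    ≡⟨ expand (ℕ→ℚ k) ⟩
  ½ * ℕ→ℚ k + ½ * 1ℚ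
    ≡⟨ cong (λ x → ½ * ℕ→ℚ k + ½ * x) (recip*n≡1 d (0<2^ k)) ⟨
  ½ * ℕ→ℚ k + ½ * (recip d * ℕ→ℚ d)
    ≡⟨ cong (½ * ℕ→ℚ k +_) (rearrange (recip d) (ℕ→ℚ d)) ⟩
  ½ * ℕ→ℚ k + ℕ→ℚ d * (recip 2 * recip d)
    ≡⟨ cong (λ x → ½ * ℕ→ℚ k + ℕ→ℚ d * x) (recip-* 2 d) ⟨
  ½ * ℕ→ℚ k + ℕ→ℚ d * recip (2 ℕ.* d)
    ≡⟨ cong (½ * ℕ→ℚ k +_) (sumFin-const d (recip (2 ℕ.* d))) ⟨
  ½ * ℕ→ℚ k + sumFin d (λ _ → recip (2 ℕ.* d))
    ≤⟨ ℚₚ.+-mono-≤ (≤totalMass-2^ k) (sumFin-mono d λ j → recip-anti (s≤s z≤n) (below j)) ⟩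
  totalMass d + sumFin d (λ j → recip (suc (d ℕ.+ toℕ j)))
    ≡⟨ totalMass-doubling k ⟨
  totalMass (2 ℕ.^ suc k) ∎
  where
  open ℚₚ.≤-Reasoning
  d = 2 ℕ.^ k
  expand : ∀ x → ½ * (1ℚ + x) ≡ ½ * x + ½ * 1ℚ
  expand = solve-∀ ℚ-ring
  rearrange : ∀ r x → ½ * (r * x) ≡ x * (½ * r)
  rearrange = solve-∀ ℚ-ring
  below : ∀ (j : Fin d) → suc (d ℕ.+ toℕ j) ≤ 2 ℕ.* d
  below j = subst₂ _≤_ (ℕₚ.+-suc d (toℕ j)) (cong (d ℕ.+_) (sym (ℕₚ.+-identityʳ d)))
    (ℕₚ.+-monoʳ-≤ d (Finₚ.toℕ<n j))

totalMass≤ : ∀ n → totalMass n ≤ℚ ℕ→ℚ (2 ℕ.+ lg n)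
totalMass≤ n = ℚₚ.≤-trans (totalMass-mono (ℕₚ.<⇒≤ (n<2^[1+lg] n))) (totalMass-2^≤ (suc (lg n)))

≤totalMass : ∀ n → 0 < n → ½ * ℕ→ℚ (lg n) ≤ℚ totalMass n
≤totalMass n 0<n = ℚₚ.≤-trans (≤totalMass-2^ (lg n)) (totalMass-mono (2^lg≤n n 0<n))

-- The tail of the squared frequencies and the numbers of columns

sumFin-telescope≤ : ∀ n (v u : ℕ → ℚ) → (∀ k → v k ≤ℚ u k - u (suc k)) → sumFin n (v ∘ toℕ) ≤ℚ u 0 - u n
sumFin-telescope≤ zero    v u h = ℚₚ.≤-reflexive (sym (ℚₚ.+-inverseʳ (u 0)))
sumFin-telescope≤ (suc n) v u h = ℚₚ.≤-trans (ℚₚ.+-mono-≤ (h 0) (sumFin-telescope≤ n (v ∘ suc) (u ∘ suc) (h ∘ suc)))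
  (ℚₚ.≤-reflexive (cancel (u 0) (u 1) (u (suc n))))
  where
  cancel : ∀ a b c → a - b + (b - c) ≡ a - c
  cancel = solve-∀ ℚ-ring

-- With x = 1/X and y = 1/(X+1): x - y = x y and x ≤ 2 y. The spurious 1ℚ factors are where x * X = 1 is inserted.
recip-sq≤ : ∀ k → sq (recip (suc k)) ≤ℚ ℕ→ℚ 2 * recip (suc k) - ℕ→ℚ 2 * recip (suc (suc k))
recip-sq≤ k = begin
  x * x                             ≤⟨ *-monoˡ x (0≤recip (suc k)) x≤2y ⟩
  x * (ℕ→ℚ 2 * y)                   ≡⟨ double x y ⟩
  (x * 1ℚ * y) + (x * 1ℚ * y) + (y * 1ℚ - y * 1ℚ) + (y * 1ℚ - y * 1ℚ)
    ≡⟨ cong₂ (λ p q → (x * 1ℚ * y) + (x * 1ℚ * y) + (y * p - y * p) + (y * q - y * q)) (sym xX) (sym xX) ⟩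
  (x * 1ℚ * y) + (x * 1ℚ * y) + (y * (x * X) - y * (x * X)) + (y * (x * X) - y * (x * X))
    ≡⟨ combine x y X ⟩
  ℕ→ℚ 2 * (x * (y * (1ℚ + X))) - ℕ→ℚ 2 * (y * (x * X))
    ≡⟨ cong₂ (λ p q → ℕ→ℚ 2 * (x * p) - ℕ→ℚ 2 * (y * q)) yX xX ⟩
  ℕ→ℚ 2 * (x * 1ℚ) - ℕ→ℚ 2 * (y * 1ℚ)
    ≡⟨ cong₂ (λ p q → ℕ→ℚ 2 * p - ℕ→ℚ 2 * q) (ℚₚ.*-identityʳ x) (ℚₚ.*-identityʳ y) ⟩
  ℕ→ℚ 2 * x - ℕ→ℚ 2 * y ∎
  where
  open ℚₚ.≤-Reasoning
  x = recip (suc k)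
  y = recip (suc (suc k))
  X = ℕ→ℚ (suc k)
  xX : x * X ≡ 1ℚ
  xX = 1/*n≡1 k
  yX : y * (1ℚ + X) ≡ 1ℚ
  yX = trans (cong (y *_) (sym (ℕ→ℚ-+ 1 (suc k)))) (1/*n≡1 (suc k))
  x≤2y : x ≤ℚ ℕ→ℚ 2 * y
  x≤2y = recip-scale 2 (suc k) (suc (suc k)) (s≤s z≤n) (s≤s z≤n)
    (subst (suc (suc k) ≤_) (cong (suc k ℕ.+_) (sym (ℕₚ.+-identityʳ (suc k)))) (s≤s (ℕₚ.m≤n+m (suc k) k)))
  double : ∀ x y → x * (ℕ→ℚ 2 * y) ≡ (x * 1ℚ * y) + (x * 1ℚ * y) + (y * 1ℚ - y * 1ℚ) + (y * 1ℚ - y * 1ℚ)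
  double = solve-∀ ℚ-ring
  combine : ∀ x y X → (x * 1ℚ * y) + (x * 1ℚ * y) + (y * (x * X) - y * (x * X)) + (y * (x * X) - y * (x * X))
    ≡ ℕ→ℚ 2 * (x * (y * (1ℚ + X))) - ℕ→ℚ 2 * (y * (x * X))
  combine = solve-∀ ℚ-ring

n≤2*[1+n/2] : ∀ n → n ≤ 2 ℕ.* suc (n ℕ./ 2)
n≤2*[1+n/2] n = begin
  n                             ≡⟨ ℕₘ.m≡m%n+[m/n]*n n 2 ⟩
  n ℕ.% 2 ℕ.+ n ℕ./ 2 ℕ.* 2     ≤⟨ ℕₚ.+-monoˡ-≤ (n ℕ./ 2 ℕ.* 2) (ℕₚ.<⇒≤ (ℕₘ.m%n<n n 2)) ⟩
  suc (n ℕ./ 2) ℕ.* 2           ≡⟨ ℕₚ.*-comm (suc (n ℕ./ 2)) 2 ⟩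
  2 ℕ.* suc (n ℕ./ 2)           ∎
  where open ℕₚ.≤-Reasoning

-- The sum is telescoped against the potential `u`. Its maximum with `b` makes `u` constant along
-- the heavy coordinates, where nothing is fed, so the sum need not be split at `b` and the case of
-- `n` at most `b` is covered too.
tail-sq≤ : ∀ n B → 0 < B → sumFin n (sq ∘ fed B) ≤ℚ ℕ→ℚ 4 * recip B
tail-sq≤ n B 0<B = begin
  sumFin n (sq ∘ fed B)              ≤⟨ sumFin-telescope≤ n v u step ⟩
  u 0 - u n                          ≤⟨ ℚₚ.+-monoʳ-≤ (u 0) (ℚₚ.neg-antimono-≤ (0≤* (0≤ℕ→ℚ 2) (0≤recip (suc (n ℕ.⊔ b))))) ⟩
  u 0 + 0ℚ                           ≡⟨ ℚₚ.+-identityʳ (u 0) ⟩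
  ℕ→ℚ 2 * recip (suc b)              ≤⟨ *-monoˡ (ℕ→ℚ 2) (0≤ℕ→ℚ 2) (recip-scale 2 (suc b) B (s≤s z≤n) 0<B (n≤2*[1+n/2] B)) ⟩
  ℕ→ℚ 2 * (ℕ→ℚ 2 * recip B)          ≡⟨ ℚₚ.*-assoc (ℕ→ℚ 2) (ℕ→ℚ 2) (recip B) ⟨
  ℕ→ℚ 4 * recip B                    ∎
  where
  open ℚₚ.≤-Reasoning
  b = B ℕ./ 2
  v u : ℕ → ℚ
  v k = sq (if suc k ℕ.≤ᵇ b then 0ℚ else recip (suc k))
  u k = ℕ→ℚ 2 * recip (suc (k ℕ.⊔ b))
  step : ∀ k → v k ≤ℚ u k - u (suc k)
  step k with suc k ℕ.≤ᵇ b in eq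
  ... | true  = ℚₚ.≤-reflexive (sym (trans
      (cong₂ (λ p q → ℕ→ℚ 2 * recip (suc p) - ℕ→ℚ 2 * recip (suc q)) (ℕₚ.m≤n⇒m⊔n≡n (ℕₚ.<⇒≤ k<b)) (ℕₚ.m≤n⇒m⊔n≡n k<b))
      (ℚₚ.+-inverseʳ (ℕ→ℚ 2 * recip (suc b)))))
    where
    k<b : suc k ≤ b
    k<b = ℕₚ.≤ᵇ⇒≤ (suc k) b (subst T (sym eq) _)
  ... | false = subst (sq (recip (suc k)) ≤ℚ_)
      (cong₂ (λ p q → ℕ→ℚ 2 * recip (suc p) - ℕ→ℚ 2 * recip (suc q))
        (sym (ℕₚ.m≥n⇒m⊔n≡m b≤k)) (sym (ℕₚ.m≥n⇒m⊔n≡m (ℕₚ.m≤n⇒m≤1+n b≤k))))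
      (recip-sq≤ k)
    where
    b≤k : b ≤ k
    b≤k = ℕₚ.≮⇒≥ (λ k<b → subst T eq (ℕₚ.≤⇒≤ᵇ k<b))

-- The first light coordinate is ⌊B/2⌋ + 1, and this 1 makes up for the floor whatever the parity of
-- `B`.
fed≤ : ∀ B {n} (i : Fin n) → 0 < B → fed B i ≤ℚ ℕ→ℚ 2 * recip B
fed≤ B i 0<B with heavy B i in eq
... | true  = 0≤* (0≤ℕ→ℚ 2) (0≤recip B)
... | false = recip-scale 2 (suc (toℕ i)) B (s≤s z≤n) 0<B
    (ℕₚ.≤-trans (n≤2*[1+n/2] B) (ℕₚ.*-monoʳ-≤ 2 (s≤s (ℕₚ.≮⇒≥ (λ i<b → subst T eq (ℕₚ.≤⇒≤ᵇ i<b))))))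

-- Rounding down loses less than one `d`, and a width of at least one column covers that loss. The
-- factor 2 therefore pays for both the rounding and the clipping at 1.
n≤2d*[1⊔n-div-d] : ∀ n d → 0 < d → n ≤ (2 ℕ.* d) ℕ.* (1 ℕ.⊔ (n div d))
n≤2d*[1⊔n-div-d] n d@(suc _) _ = begin
  n                               ≡⟨ ℕₘ.m≡m%n+[m/n]*n n d ⟩
  n ℕ.% d ℕ.+ n ℕ./ d ℕ.* d       ≤⟨ ℕₚ.+-monoˡ-≤ (n ℕ./ d ℕ.* d) (ℕₚ.<⇒≤ (ℕₘ.m%n<n n d)) ⟩
  d ℕ.+ n ℕ./ d ℕ.* d             ≡⟨ cong (ℕ._+ n ℕ./ d ℕ.* d) (ℕₚ.*-identityˡ d) ⟨
  1 ℕ.* d ℕ.+ n ℕ./ d ℕ.* d       ≤⟨ ℕₚ.+-mono-≤ (ℕₚ.*-monoˡ-≤ d (ℕₚ.m≤m⊔n 1 (n ℕ./ d))) (ℕₚ.*-monoˡ-≤ d (ℕₚ.m≤n⊔m 1 (n ℕ./ d))) ⟩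
  w ℕ.* d ℕ.+ w ℕ.* d             ≡⟨ rearrange w d ⟩
  (2 ℕ.* d) ℕ.* w                 ∎
  where
  open ℕₚ.≤-Reasoning
  w = 1 ℕ.⊔ (n ℕ./ d)
  rearrange : ∀ w d → w ℕ.* d ℕ.+ w ℕ.* d ≡ (2 ℕ.* d) ℕ.* w
  rearrange = ℕ-solve-∀

recip-columns≤ : ∀ B d → 0 < B → 0 < d → recip (1 ℕ.⊔ (B div d)) ≤ℚ ℕ→ℚ (2 ℕ.* d) * recip B
recip-columns≤ B d 0<B 0<d = recip-scale (2 ℕ.* d) (1 ℕ.⊔ (B div d)) B
  (ℕₚ.m≤m⊔n 1 (B div d)) 0<B (n≤2d*[1⊔n-div-d] B d 0<d)

recip-2^*≤2 : ∀ m k → k < 2 ℕ.^ suc m → recip (2 ℕ.^ m) * ℕ→ℚ k ≤ℚ ℕ→ℚ 2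
recip-2^*≤2 m k k< = begin
  r * ℕ→ℚ k                         ≤⟨ *-monoˡ r (0≤recip (2 ℕ.^ m)) (ℕ→ℚ-mono (ℕₚ.<⇒≤ k<)) ⟩
  r * ℕ→ℚ (2 ℕ.^ suc m)             ≡⟨ cong (r *_) (ℕ→ℚ-* 2 (2 ℕ.^ m)) ⟩
  r * (ℕ→ℚ 2 * ℕ→ℚ (2 ℕ.^ m))       ≡⟨ rearrange r (ℕ→ℚ 2) (ℕ→ℚ (2 ℕ.^ m)) ⟩
  ℕ→ℚ 2 * (r * ℕ→ℚ (2 ℕ.^ m))       ≡⟨ cong (ℕ→ℚ 2 *_) (recip*n≡1 (2 ℕ.^ m) (0<2^ m)) ⟩
  ℕ→ℚ 2 * 1ℚ                        ∎
  where
  open ℚₚ.≤-Reasoning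
  r = recip (2 ℕ.^ m)
  rearrange : ∀ a b c → a * (b * c) ≡ b * (a * c)
  rearrange = solve-∀ ℚ-ring

-- The error bound

-- With a = |e| and `ι * β ≡ 1ℚ`, the difference of the two sides is β(a - ι)² + a. The product with
-- `1ℚ - ι * β` in `expand` marks where that relation is used in an otherwise pure ring identity.
∣∣≤-by-sq : ∀ ι β e → 0ℚ ≤ℚ β → ι * β ≡ 1ℚ → ∣ e ∣ ≤ℚ ι + β * sq e
∣∣≤-by-sq ι β e 0≤β ιβ = ≤-from-diff (subst (0ℚ ≤ℚ_) (begin
  β * sq (a - ι) + a                            ≡⟨ expand β a ι ⟩
  β * sq a + (1ℚ - ι * β) * (a + a - ι) + (ι - a)
    ≡⟨ cong (λ x → β * sq a + (1ℚ - x) * (a + a - ι) + (ι - a)) ιβ ⟩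
  β * sq a + (1ℚ - 1ℚ) * (a + a - ι) + (ι - a)   ≡⟨ collect β (sq a) a ι ⟩
  ι + β * sq a - a                              ≡⟨ cong (λ x → ι + β * x - a) (sq-∣-∣ e) ⟩
  ι + β * sq e - a                              ∎)
  (0≤+ (0≤* 0≤β (0≤sq (a - ι))) (ℚₚ.0≤∣p∣ e)))
  where
  open ≡-Reasoning
  a = ∣ e ∣
  expand : ∀ β a ι → β * ((a - ι) * (a - ι)) + a ≡ β * (a * a) + (1ℚ - ι * β) * (a + a - ι) + (ι - a)
  expand = solve-∀ ℚ-ring
  collect : ∀ β s a ι → β * s + (1ℚ - 1ℚ) * (a + a - ι) + (ι - a) ≡ ι + β * s - a
  collect = solve-∀ ℚ-ring

-- At least 1/4 everywhere and at least 4 above τ = 1/ρ when v ≤ τ/2; being quadratic, its expectation is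
-- controlled by the second moment of the error x - v.
weight : ℚ → ℚ → ℚ → ℚ
weight ρ v x = ℤ.+ 1 / 4 + ℕ→ℚ 15 * sq (ρ * (x - v))

¼≤weight : ∀ ρ v x → ℤ.+ 1 / 4 ≤ℚ weight ρ v x
¼≤weight ρ v x = subst (_≤ℚ weight ρ v x) (ℚₚ.+-identityʳ (ℤ.+ 1 / 4))
  (ℚₚ.+-monoʳ-≤ (ℤ.+ 1 / 4) (0≤* (0≤ℕ→ℚ 15) (0≤sq (ρ * (x - v)))))

-- An estimate above `τ` is off by at least τ/2, hence by 1/2 after scaling with `ρ`. The
-- coefficient 15 is chosen so that 1/4 + 15 · (1/2)² = 4.
4≤weight : ∀ ρ v τ → 0ℚ ≤ℚ ρ → ρ * τ ≡ 1ℚ → v ≤ℚ ½ * τ → ∀ x → τ ≤ℚ x → ℕ→ℚ 4 ≤ℚ weight ρ v x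
4≤weight ρ v τ 0≤ρ ρτ v≤½τ x τ≤x = ℚₚ.+-monoʳ-≤ (ℤ.+ 1 / 4) (*-monoˡ (ℕ→ℚ 15) (0≤ℕ→ℚ 15)
  (*-mono (ℚₚ.≤-trans (≤-numeral 0ℚ ½) ½≤) (≤-numeral 0ℚ ½) ½≤ ½≤))
  where
  half : ∀ ρ τ → ½ * (ρ * τ) ≡ ρ * (τ - ½ * τ)
  half = solve-∀ ℚ-ring
  ½≤ : ½ ≤ℚ ρ * (x - v)
  ½≤ = subst (_≤ℚ ρ * (x - v)) (trans (sym (half ρ τ)) (cong (½ *_) ρτ))
    (*-monoˡ ρ 0≤ρ (ℚₚ.+-mono-≤ τ≤x (ℚₚ.neg-antimono-≤ v≤½τ)))

0≤weight : ∀ ρ v x → 0ℚ ≤ℚ weight ρ v x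
0≤weight ρ v x = ℚₚ.≤-trans (≤-numeral 0ℚ (ℤ.+ 1 / 4)) (¼≤weight ρ v x)

𝔼-weight≤ : ∀ n w (g : Fin n → ℚ) i ρ → 𝔼 (allTables n w) (λ t → weight ρ (g i) (csEstimate t g i))
  ≤ℚ ℤ.+ 1 / 4 + ℕ→ℚ 15 * (sq ρ * (ℕ→ℚ 3 * (recip w * sumFin n (sq ∘ g))))
𝔼-weight≤ n w g i ρ = begin
  𝔼 ts (λ t → ℤ.+ 1 / 4 + ℕ→ℚ 15 * sq (ρ * err t))
    ≡⟨ 𝔼-cong ts (λ t → cong (ℤ.+ 1 / 4 +_) (factor (ℕ→ℚ 15) ρ (err t))) ⟩
  𝔼 ts (λ t → ℤ.+ 1 / 4 + ℕ→ℚ 15 * sq ρ * sq (err t))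
    ≡⟨ 𝔼-+ ts (λ _ → ℤ.+ 1 / 4) _ ⟩
  𝔼 ts (λ _ → ℤ.+ 1 / 4) + 𝔼 ts (λ t → ℕ→ℚ 15 * sq ρ * sq (err t))
    ≤⟨ ℚₚ.+-mono-≤ (𝔼-const≤ ts (≤-numeral 0ℚ (ℤ.+ 1 / 4))) (ℚₚ.≤-reflexive (𝔼-*ˡ ts (sq ∘ err) (ℕ→ℚ 15 * sq ρ))) ⟩
  ℤ.+ 1 / 4 + ℕ→ℚ 15 * sq ρ * 𝔼 ts (sq ∘ err)
    ≤⟨ ℚₚ.+-monoʳ-≤ (ℤ.+ 1 / 4) (*-monoˡ (ℕ→ℚ 15 * sq ρ) (0≤* (0≤ℕ→ℚ 15) (0≤sq ρ)) (𝔼-tableError-sq≤ n w g i)) ⟩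
  ℤ.+ 1 / 4 + ℕ→ℚ 15 * sq ρ * (ℕ→ℚ 3 * (recip w * sumFin n (sq ∘ g)))
    ≡⟨ cong (ℤ.+ 1 / 4 +_) (ℚₚ.*-assoc (ℕ→ℚ 15) (sq ρ) _) ⟩
  ℤ.+ 1 / 4 + ℕ→ℚ 15 * (sq ρ * (ℕ→ℚ 3 * (recip w * sumFin n (sq ∘ g)))) ∎
  where
  open ℚₚ.≤-Reasoning
  ts = allTables n w
  err : Table n w → ℚ
  err t = csEstimate t g i - g i
  factor : ∀ c ρ e → c * ((ρ * e) * (ρ * e)) ≡ c * (ρ * ρ) * (e * e)
  factor = solve-∀ ℚ-ring

𝔼-∣tableError∣≤ : ∀ n w (g : Fin n → ℚ) i ι β → 0ℚ ≤ℚ ι → 0ℚ ≤ℚ β → ι * β ≡ 1ℚ →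
  𝔼 (allTables n w) (λ t → ∣ csEstimate t g i - g i ∣) ≤ℚ ι + β * (ℕ→ℚ 3 * (recip w * sumFin n (sq ∘ g)))
𝔼-∣tableError∣≤ n w g i ι β 0≤ι 0≤β ιβ = begin
  𝔼 ts (∣_∣ ∘ err)                            ≤⟨ 𝔼-mono ts (λ t → ∣∣≤-by-sq ι β (err t) 0≤β ιβ) ⟩
  𝔼 ts (λ t → ι + β * sq (err t))             ≡⟨ 𝔼-+ ts (λ _ → ι) _ ⟩
  𝔼 ts (λ _ → ι) + 𝔼 ts (λ t → β * sq (err t)) ≤⟨ ℚₚ.+-mono-≤ (𝔼-const≤ ts 0≤ι) (ℚₚ.≤-reflexive (𝔼-*ˡ ts (sq ∘ err) β)) ⟩
  ι + β * 𝔼 ts (sq ∘ err)                     ≤⟨ ℚₚ.+-monoʳ-≤ ι (*-monoˡ β 0≤β (𝔼-tableError-sq≤ n w g i)) ⟩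
  ι + β * (ℕ→ℚ 3 * (recip w * sumFin n (sq ∘ g))) ∎
  where
  open ℚₚ.≤-Reasoning
  ts = allTables n w
  err : Table n w → ℚ
  err t = csEstimate t g i - g i

-- Either the query is answered by 0, at cost z², or the median reaches τ and p ≥ 1 pays for the estimate.
error-split : ∀ heavy? z est med τ p (below : Dec (med <ℚ τ)) → 0ℚ ≤ℚ z → 0ℚ ≤ℚ p → (τ ≤ℚ med → 1ℚ ≤ℚ p) →
  z * ∣ z - (if heavy? then z else (if does below then 0ℚ else est)) ∣
  ≤ℚ sq (if heavy? then 0ℚ else z) + z * (p * ∣ est - (if heavy? then 0ℚ else z) ∣)
error-split true z est med τ p _ 0≤z 0≤p h = begin
  z * ∣ z - z ∣                   ≡⟨ cong (λ x → z * ∣ x ∣) (ℚₚ.+-inverseʳ z) ⟩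
  z * 0ℚ                          ≡⟨ ℚₚ.*-zeroʳ z ⟩
  0ℚ                              ≤⟨ 0≤+ ℚₚ.≤-refl (0≤* 0≤z (0≤* 0≤p (ℚₚ.0≤∣p∣ (est - 0ℚ)))) ⟩
  sq 0ℚ + z * (p * ∣ est - 0ℚ ∣)  ∎
  where open ℚₚ.≤-Reasoning
error-split false z est med τ p (yes _) 0≤z 0≤p h = begin
  z * ∣ z - 0ℚ ∣                  ≡⟨ cong (λ x → z * ∣ x ∣) (ℚₚ.+-identityʳ z) ⟩
  z * ∣ z ∣                       ≡⟨ cong (z *_) (ℚₚ.0≤p⇒∣p∣≡p 0≤z) ⟩
  sq z                            ≡⟨ ℚₚ.+-identityʳ (sq z) ⟨
  sq z + 0ℚ                       ≤⟨ ℚₚ.+-monoʳ-≤ (sq z) (0≤* 0≤z (0≤* 0≤p (ℚₚ.0≤∣p∣ (est - z)))) ⟩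
  sq z + z * (p * ∣ est - z ∣)    ∎
  where open ℚₚ.≤-Reasoning
error-split false z est med τ p (no med≮τ) 0≤z 0≤p h = begin
  z * ∣ z - est ∣                 ≡⟨ cong (z *_) (trans (sym (ℚₚ.∣-p∣≡∣p∣ (z - est))) (cong ∣_∣ (swap-diff z est))) ⟩
  z * ∣ est - z ∣                 ≡⟨ cong (z *_) (ℚₚ.*-identityˡ ∣ est - z ∣) ⟨
  z * (1ℚ * ∣ est - z ∣)          ≤⟨ *-monoˡ z 0≤z (*-monoʳ ∣ est - z ∣ (ℚₚ.0≤∣p∣ (est - z)) (h (ℚₚ.≮⇒≥ med≮τ))) ⟩
  z * (p * ∣ est - z ∣)           ≡⟨ ℚₚ.+-identityˡ _ ⟨
  0ℚ + z * (p * ∣ est - z ∣)      ≤⟨ ℚₚ.+-monoˡ-≤ (z * (p * ∣ est - z ∣)) (0≤sq z) ⟩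
  sq z + z * (p * ∣ est - z ∣)    ∎
  where
  open ℚₚ.≤-Reasoning
  swap-diff : ∀ a b → ℚ.- (a - b) ≡ b - a
  swap-diff = solve-∀ ℚ-ring

-- The bound for fixed `n` and `B`

module Bound (n B : ℕ) (4≤n : 4 ≤ n) (lg≤B : lg n ≤ B) where

  2≤lg : 2 ≤ lg n
  2≤lg = subst (_≤ lg n) (⌊log₂[2^n]⌋≡n 2) (⌊log₂⌋-mono-≤ 4≤n)

  -- This makes T at least 2, so there is at least one small table and `τ` is positive.
  1≤lglg : 1 ≤ lglg n
  1≤lglg = subst (_≤ lglg n) (⌊log₂[2^n]⌋≡n 1) (⌊log₂⌋-mono-≤ 2≤lg)

  0<lg : 0 < lg n
  0<lg = ℕₚ.<-trans (s≤s z≤n) 2≤lg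

  0<B : 0 < B
  0<B = ℕₚ.≤-trans 0<lg lg≤B

  L m : ℕ
  L = lglg n
  m = numTables 2 n ℕ.∸ 1

  -- The reciprocals `λ′` of `ℓ` and `ι` of `β` are separate atoms: the ring solver regroups terms
  -- until `λ′ * ℓ` and `ι * β` appear, and these are then rewritten to 1. `ρ` is the inverse of
  -- `τ`.
  ℓ λ′ β ι ν τ ρ : ℚ
  ℓ  = ℕ→ℚ L
  λ′ = recip L
  β  = ℕ→ℚ B
  ι  = recip B
  ν  = ℕ→ℚ (lg n)
  τ  = threshold (ℕ→ℚ 200) n B
  ρ  = recip 200 * (λ′ * β)

  λℓ : λ′ * ℓ ≡ 1ℚ
  λℓ = recip*n≡1 L 1≤lglg

  ιβ : ι * β ≡ 1ℚ
  ιβ = recip*n≡1 B 0<B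

  0≤ι : 0ℚ ≤ℚ ι
  0≤ι = 0≤recip B

  0≤β : 0ℚ ≤ℚ β
  0≤β = 0≤ℕ→ℚ B

  0≤ρ : 0ℚ ≤ℚ ρ
  0≤ρ = 0≤* (0≤recip 200) (0≤* (0≤recip L) 0≤β)

  τ≡ : τ ≡ ℕ→ℚ 200 * (ℓ * ι)
  τ≡ = cong (ℕ→ℚ 200 *_) (⊘-ℕ ℓ B 0<B)

  ρτ : ρ * τ ≡ 1ℚ
  ρτ = begin
    ρ * τ                                              ≡⟨ cong (ρ *_) τ≡ ⟩
    recip 200 * (λ′ * β) * (ℕ→ℚ 200 * (ℓ * ι))         ≡⟨ rearrange λ′ β ℓ ι ⟩
    (λ′ * ℓ) * (ι * β)                                 ≡⟨ cong₂ _*_ λℓ ιβ ⟩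
    1ℚ * 1ℚ                                            ∎
    where
    open ≡-Reasoning
    rearrange : ∀ a b c d → recip 200 * (a * b) * (ℕ→ℚ 200 * (c * d)) ≡ (a * c) * (d * b)
    rearrange = solve-∀ ℚ-ring

  g : Fin n → ℚ
  g = fed B

  g≤½τ : ∀ i → g i ≤ℚ ½ * τ
  g≤½τ i = begin
    g i                        ≤⟨ fed≤ B i 0<B ⟩
    ℕ→ℚ 2 * ι                  ≤⟨ *-monoʳ ι 0≤ι (≤-numeral (ℕ→ℚ 2) (ℕ→ℚ 100)) ⟩
    ℕ→ℚ 100 * ι                ≡⟨ cong (ℕ→ℚ 100 *_) (ℚₚ.*-identityˡ ι) ⟨
    ℕ→ℚ 100 * (1ℚ * ι)         ≤⟨ *-monoˡ (ℕ→ℚ 100) (0≤ℕ→ℚ 100) (*-monoʳ ι 0≤ι (ℕ→ℚ-mono 1≤lglg)) ⟩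
    ℕ→ℚ 100 * (ℓ * ι)          ≡⟨ ℚₚ.*-assoc ½ (ℕ→ℚ 200) (ℓ * ι) ⟩
    ½ * (ℕ→ℚ 200 * (ℓ * ι))    ≡⟨ cong (½ *_) τ≡ ⟨
    ½ * τ                      ∎
    where open ℚₚ.≤-Reasoning

  tail≤ : sumFin n (sq ∘ g) ≤ℚ ℕ→ℚ 4 * ι
  tail≤ = tail-sq≤ n B 0<B

  0≤tail : 0ℚ ≤ℚ sumFin n (sq ∘ g)
  0≤tail = sumFin-nonneg n (λ j → 0≤sq (g j))

  smallColumns≤ : recip (colsSmall 2 n B) ≤ℚ ℕ→ℚ 48 * (ℓ * ι)
  smallColumns≤ = subst (recip (colsSmall 2 n B) ≤ℚ_)
    (trans (cong (_* ι) (trans (cong ℕ→ℚ (assemble L)) (ℕ→ℚ-* 48 L))) (ℚₚ.*-assoc (ℕ→ℚ 48) ℓ ι))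
    (recip-columns≤ B (12 ℕ.* numTables 2 n) 0<B (ℕₚ.≤-trans 1≤lglg (L≤ L)))
    where
    assemble : ∀ L → 2 ℕ.* (12 ℕ.* (2 ℕ.* L)) ≡ 48 ℕ.* L
    assemble = ℕ-solve-∀
    L≤ : ∀ L → L ≤ 12 ℕ.* (2 ℕ.* L)
    L≤ L = ℕₚ.≤-trans (ℕₚ.m≤n*m L 2) (ℕₚ.m≤n*m (2 ℕ.* L) 12)

  bigColumns≤ : recip (colsBig B) ≤ℚ ℕ→ℚ 24 * ι
  bigColumns≤ = recip-columns≤ B 12 0<B (s≤s z≤n)

  0≤48ℓι : 0ℚ ≤ℚ ℕ→ℚ 48 * (ℓ * ι)
  0≤48ℓι = 0≤* (0≤ℕ→ℚ 48) (0≤* (0≤ℕ→ℚ L) 0≤ι)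

  smalls : List (Table n (colsSmall 2 n B))
  smalls = allTables n (colsSmall 2 n B)

  bigs : List (Table n (colsBig B))
  bigs = allTables n (colsBig B)

  wt : Fin n → Table n (colsSmall 2 n B) → ℚ
  wt i t = weight ρ (g i) (csEstimate t g i)

  𝔼-wt≤½ : ∀ i → 𝔼 smalls (wt i) ≤ℚ recip 2
  𝔼-wt≤½ i = begin
    𝔼 smalls (wt i)
      ≤⟨ 𝔼-weight≤ n (colsSmall 2 n B) g i ρ ⟩
    ℤ.+ 1 / 4 + ℕ→ℚ 15 * (sq ρ * (ℕ→ℚ 3 * (recip (colsSmall 2 n B) * sumFin n (sq ∘ g))))
      ≤⟨ ℚₚ.+-monoʳ-≤ (ℤ.+ 1 / 4) (*-monoˡ (ℕ→ℚ 15) (0≤ℕ→ℚ 15) (*-monoˡ (sq ρ) (0≤sq ρ) (*-monoˡ (ℕ→ℚ 3) (0≤ℕ→ℚ 3)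
           (*-mono 0≤48ℓι 0≤tail smallColumns≤ tail≤)))) ⟩
    ℤ.+ 1 / 4 + ℕ→ℚ 15 * (sq ρ * (ℕ→ℚ 3 * (ℕ→ℚ 48 * (ℓ * ι) * (ℕ→ℚ 4 * ι))))
      -- The constant is 15 · 3 · 48 · 4 / 200² = 27/125. The narrow tables contribute one factor
      -- `ℓ` and `sq ρ` two factors `λ′`, so one `λ′` survives, and it is at most 1.
      ≡⟨ cong (ℤ.+ 1 / 4 +_) (rearrange λ′ β ℓ ι) ⟩
    ℤ.+ 1 / 4 + ℤ.+ 27 / 125 * (λ′ * ((λ′ * ℓ) * ((ι * β) * (ι * β))))
      ≡⟨ cong₂ (λ x y → ℤ.+ 1 / 4 + ℤ.+ 27 / 125 * (λ′ * (x * (y * y)))) λℓ ιβ ⟩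
    ℤ.+ 1 / 4 + ℤ.+ 27 / 125 * (λ′ * 1ℚ)
      ≤⟨ ℚₚ.+-monoʳ-≤ (ℤ.+ 1 / 4) (*-monoˡ (ℤ.+ 27 / 125) (≤-numeral 0ℚ (ℤ.+ 27 / 125))
           (*-monoʳ 1ℚ (≤-numeral 0ℚ 1ℚ) (recip-anti (s≤s z≤n) 1≤lglg))) ⟩
    ℤ.+ 1 / 4 + ℤ.+ 27 / 125 * 1ℚ
      ≤⟨ ≤-numeral (ℤ.+ 1 / 4 + ℤ.+ 27 / 125 * 1ℚ) (recip 2) ⟩
    recip 2 ∎
    where
    open ℚₚ.≤-Reasoning
    rearrange : ∀ a b c d → ℕ→ℚ 15 * ((recip 200 * (a * b)) * (recip 200 * (a * b)) * (ℕ→ℚ 3 * (ℕ→ℚ 48 * (c * d) * (ℕ→ℚ 4 * d))))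
      ≡ ℤ.+ 27 / 125 * (a * ((a * c) * ((d * b) * (d * b))))
    rearrange = solve-∀ ℚ-ring

  payment : Fin n → Vec (Table n (colsSmall 2 n B)) m → ℚ
  payment i v = prodList (overVec (wt i) v)

  0≤payment : ∀ i v → 0ℚ ≤ℚ payment i v
  0≤payment i v = prodList-overVec-nonneg (wt i) (λ t → 0≤weight ρ (g i) (csEstimate t g i)) v

  𝔼-payment≤ : ∀ i → 𝔼 (allVecs m smalls) (payment i) ≤ℚ recip (2 ℕ.^ m)
  𝔼-payment≤ i = 𝔼-allVecs-prod≤ m smalls (wt i) 2 (λ t → 0≤weight ρ (g i) (csEstimate t g i)) (𝔼-wt≤½ i)

  m-odd : m ≡ (L ℕ.∸ 1) ℕ.+ suc (L ℕ.∸ 1)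
  m-odd = odd L 1≤lglg
    where
    odd : ∀ L → 1 ≤ L → 2 ℕ.* L ℕ.∸ 1 ≡ (L ℕ.∸ 1) ℕ.+ suc (L ℕ.∸ 1)
    odd (suc L) _ = cong (λ x → L ℕ.+ suc x) (ℕₚ.+-identityʳ L)

  1≤payment : ∀ i v → τ ≤ℚ median (overVec (λ t → csEstimate t g i) v) → 1ℚ ≤ℚ payment i v
  1≤payment i v h = subst (λ xs → 1ℚ ≤ℚ prodList xs) (map-overVec (weight ρ (g i)) (λ t → csEstimate t g i) v)
    (Majority.1≤prod (weight ρ (g i)) τ (¼≤weight ρ (g i)) (4≤weight ρ (g i) τ 0≤ρ ρτ (g≤½τ i))
      (overVec (λ t → csEstimate t g i) v) (L ℕ.∸ 1)
      (trans (Vecₚ.length-toList (Vec.map (λ t → csEstimate t g i) v)) m-odd) h)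

  bigError : Fin n → Table n (colsBig B) → ℚ
  bigError i t = ∣ csEstimate t g i - g i ∣

  𝔼-bigError≤ : ∀ i → 𝔼 bigs (bigError i) ≤ℚ ℕ→ℚ 289 * ι
  𝔼-bigError≤ i = begin
    𝔼 bigs (bigError i)
      -- The second moment is at most 3 · 24 · 4 / B² = 288/B², so with `ι` = 1/B and `β` = B both
      -- terms have order 1/B.
      ≤⟨ 𝔼-∣tableError∣≤ n (colsBig B) g i ι β 0≤ι 0≤β ιβ ⟩
    ι + β * (ℕ→ℚ 3 * (recip (colsBig B) * sumFin n (sq ∘ g)))
      ≤⟨ ℚₚ.+-monoʳ-≤ ι (*-monoˡ β 0≤β (*-monoˡ (ℕ→ℚ 3) (0≤ℕ→ℚ 3)
           (*-mono (0≤* (0≤ℕ→ℚ 24) 0≤ι) 0≤tail bigColumns≤ tail≤))) ⟩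
    ι + β * (ℕ→ℚ 3 * (ℕ→ℚ 24 * ι * (ℕ→ℚ 4 * ι)))
      ≡⟨ rearrange ι β ⟩
    ι + ℕ→ℚ 288 * ((ι * β) * ι)
      ≡⟨ cong (λ x → ι + ℕ→ℚ 288 * (x * ι)) ιβ ⟩
    ι + ℕ→ℚ 288 * (1ℚ * ι)
      ≡⟨ collect ι ⟩
    ℕ→ℚ 289 * ι ∎
    where
    open ℚₚ.≤-Reasoning
    rearrange : ∀ a b → a + b * (ℕ→ℚ 3 * (ℕ→ℚ 24 * a * (ℕ→ℚ 4 * a))) ≡ a + ℕ→ℚ 288 * ((a * b) * a)
    rearrange = solve-∀ ℚ-ring
    collect : ∀ a → a + ℕ→ℚ 288 * (1ℚ * a) ≡ ℕ→ℚ 289 * a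
    collect = solve-∀ ℚ-ring

  configs : List (Config 2 n B)
  configs = allConfigs 2 n B

  coordinateError : Fin n → Config 2 n B → ℚ
  coordinateError i c = zipf i * ∣ zipf i - answer 2 (ℕ→ℚ 200) n B c i ∣

  coordinateError≤ : ∀ i v t → coordinateError i (v , t) ≤ℚ sq (g i) + zipf i * (payment i v * bigError i t)
  coordinateError≤ i v t = error-split (heavy B i) (zipf i) (csEstimate t g i)
    (median (overVec (λ t → csEstimate t g i) v)) τ (payment i v) (_ ℚₚ.<? _)
    (0≤zipf i) (0≤payment i v) (1≤payment i v)

  p : ℚ
  p = recip (2 ℕ.^ m)

  𝔼-coordinateError≤ : ∀ i → 𝔼 configs (coordinateError i) ≤ℚ sq (g i) + p * (ℕ→ℚ 289 * ι) * zipf i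
  𝔼-coordinateError≤ i = begin
    𝔼 configs (coordinateError i)
      ≤⟨ 𝔼-mono configs (λ { (v , t) → coordinateError≤ i v t }) ⟩
    𝔼 configs (λ c → sq (g i) + zipf i * prod c)
      ≡⟨ 𝔼-+ configs (λ _ → sq (g i)) _ ⟩
    𝔼 configs (λ _ → sq (g i)) + 𝔼 configs (λ c → zipf i * prod c)
      ≤⟨ ℚₚ.+-mono-≤ (𝔼-const≤ configs (0≤sq (g i))) (ℚₚ.≤-reflexive (𝔼-*ˡ configs prod (zipf i))) ⟩
    sq (g i) + zipf i * 𝔼 configs prod
      ≡⟨ cong (λ x → sq (g i) + zipf i * x) independent ⟩
    sq (g i) + zipf i * (𝔼 (allVecs m smalls) (payment i) * 𝔼 bigs (bigError i))
      ≤⟨ ℚₚ.+-monoʳ-≤ (sq (g i)) (*-monoˡ (zipf i) (0≤zipf i)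
           (*-mono (0≤recip (2 ℕ.^ m)) (𝔼-nonneg bigs (λ t → ℚₚ.0≤∣p∣ (csEstimate t g i - g i)))
             (𝔼-payment≤ i) (𝔼-bigError≤ i))) ⟩
    sq (g i) + zipf i * (p * (ℕ→ℚ 289 * ι))
      ≡⟨ cong (sq (g i) +_) (ℚₚ.*-comm (zipf i) _) ⟩
    sq (g i) + p * (ℕ→ℚ 289 * ι) * zipf i ∎
    where
    open ℚₚ.≤-Reasoning
    prod : Config 2 n B → ℚ
    prod (v , t) = payment i v * bigError i t
    -- Whether to answer 0 is decided by the small tables alone, while the error comes from the
    -- large one; the product structure of `configs` separates the two averages.
    independent : 𝔼 configs prod ≡ 𝔼 (allVecs m smalls) (payment i) * 𝔼 bigs (bigError i)
    independent = trans (𝔼-⊗ (allVecs m smalls) bigs prod)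
      (trans (𝔼-cong (allVecs m smalls) (λ v → 𝔼-*ˡ bigs (bigError i) (payment i v)))
             (𝔼-*ʳ (allVecs m smalls) (payment i) (𝔼 bigs (bigError i))))

  -- This is what forces T to grow like lglg n: with at least `lglg n` small tables, the factor 2^-m
  -- outweighs a harmonic mass of order lg n.
  lg<2^ : lg n < 2 ℕ.^ suc m
  lg<2^ = ℕₚ.<-≤-trans (n<2^[1+lg] (lg n)) (ℕₚ.^-monoʳ-≤ 2 (s≤s (L≤2L∸1 L 1≤lglg)))
    where
    L≤2L∸1 : ∀ L → 1 ≤ L → L ≤ 2 ℕ.* L ℕ.∸ 1
    L≤2L∸1 (suc L) _ = ℕₚ.≤-trans (s≤s (ℕₚ.m≤m+n L 0)) (ℕₚ.m≤n+m (suc (L ℕ.+ 0)) L)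

  p*mass≤4 : p * totalMass n ≤ℚ ℕ→ℚ 4
  p*mass≤4 = begin
    p * totalMass n             ≤⟨ *-monoˡ p (0≤recip (2 ℕ.^ m)) (ℚₚ.≤-trans (totalMass≤ n) (ℕ→ℚ-mono 2+lg≤)) ⟩
    p * ℕ→ℚ (2 ℕ.* lg n)        ≡⟨ cong (p *_) (ℕ→ℚ-* 2 (lg n)) ⟩
    p * (ℕ→ℚ 2 * ν)             ≡⟨ rearrange p ν ⟩
    ℕ→ℚ 2 * (p * ν)             ≤⟨ *-monoˡ (ℕ→ℚ 2) (0≤ℕ→ℚ 2) (recip-2^*≤2 m (lg n) lg<2^) ⟩
    ℕ→ℚ 2 * ℕ→ℚ 2               ≡⟨⟩
    ℕ→ℚ 4                       ∎
    where
    open ℚₚ.≤-Reasoning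
    2+lg≤ : 2 ℕ.+ lg n ≤ 2 ℕ.* lg n
    2+lg≤ = ℕₚ.+-mono-≤ 2≤lg (ℕₚ.≤-reflexive (sym (ℕₚ.+-identityʳ (lg n))))
    rearrange : ∀ a b → a * (ℕ→ℚ 2 * b) ≡ ℕ→ℚ 2 * (a * b)
    rearrange = solve-∀ ℚ-ring

  totalError : Config 2 n B → ℚ
  totalError c = sumFin n (λ i → coordinateError i c)

  𝔼-totalError≤ : 𝔼 configs totalError ≤ℚ ℕ→ℚ 1160 * ι
  𝔼-totalError≤ = begin
    𝔼 configs totalError
      ≡⟨ 𝔼-sumFin configs n coordinateError ⟩
    sumFin n (λ i → 𝔼 configs (coordinateError i))
      ≤⟨ sumFin-mono n 𝔼-coordinateError≤ ⟩
    sumFin n (λ i → sq (g i) + p * (ℕ→ℚ 289 * ι) * zipf i)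
      ≡⟨ sumFin-+ n (sq ∘ g) _ ⟩
    sumFin n (sq ∘ g) + sumFin n (λ i → p * (ℕ→ℚ 289 * ι) * zipf i)
      ≡⟨ cong (sumFin n (sq ∘ g) +_) (sumFin-*ˡ n (p * (ℕ→ℚ 289 * ι)) zipf) ⟩
    sumFin n (sq ∘ g) + p * (ℕ→ℚ 289 * ι) * totalMass n
      ≡⟨ cong (sumFin n (sq ∘ g) +_) (rearrange p (ℕ→ℚ 289 * ι) (totalMass n)) ⟩
    sumFin n (sq ∘ g) + p * totalMass n * (ℕ→ℚ 289 * ι)
      -- Zero answers cost 4/B, and the large table costs 289/B times `p * totalMass n`, at most 4;
      -- hence 4 + 4 · 289 = 1160.
      ≤⟨ ℚₚ.+-mono-≤ tail≤ (*-monoʳ (ℕ→ℚ 289 * ι) (0≤* (0≤ℕ→ℚ 289) 0≤ι) p*mass≤4) ⟩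
    ℕ→ℚ 4 * ι + ℕ→ℚ 4 * (ℕ→ℚ 289 * ι)
      ≡⟨ collect ι ⟩
    ℕ→ℚ 1160 * ι ∎
    where
    open ℚₚ.≤-Reasoning
    rearrange : ∀ a b c → a * b * c ≡ a * c * b
    rearrange = solve-∀ ℚ-ring
    collect : ∀ a → ℕ→ℚ 4 * a + ℕ→ℚ 4 * (ℕ→ℚ 289 * a) ≡ ℕ→ℚ 1160 * a
    collect = solve-∀ ℚ-ring

  0<mass : 0ℚ <ℚ totalMass n
  0<mass = ℚₚ.<-≤-trans (ℚₚ.positive⁻¹ 1ℚ) (totalMass-mono {1} (ℕₚ.≤-trans (s≤s z≤n) 4≤n))

  1⊘mass≤ : 1ℚ ⊘ totalMass n ≤ℚ ℕ→ℚ 2 * recip (lg n)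
  1⊘mass≤ = *-cancelʳ (totalMass n) 0<mass (begin
    (1ℚ ⊘ totalMass n) * totalMass n        ≡⟨ ⊘-inverse (totalMass n) 0<mass ⟩
    1ℚ                                      ≡⟨ recip*n≡1 (lg n) 0<lg ⟨
    recip (lg n) * ν                        ≡⟨ rearrange (recip (lg n)) ν ⟩
    ℕ→ℚ 2 * recip (lg n) * (½ * ν)          ≤⟨ *-monoˡ (ℕ→ℚ 2 * recip (lg n)) (0≤* (0≤ℕ→ℚ 2) (0≤recip (lg n)))
                                                 (≤totalMass n (ℕₚ.≤-trans (s≤s z≤n) 4≤n)) ⟩
    ℕ→ℚ 2 * recip (lg n) * totalMass n      ∎)
    where
    open ℚₚ.≤-Reasoning
    rearrange : ∀ a b → a * b ≡ ℕ→ℚ 2 * a * (½ * b)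
    rearrange = solve-∀ ℚ-ring

  bound : expectedWeightedError 2 (ℕ→ℚ 200) n B ≤ℚ ℕ→ℚ 2320 ⊘ ℕ→ℚ (B ℕ.* lg n)
  bound = begin
    𝔼 configs (λ c → totalError c ⊘ totalMass n)
      ≡⟨ 𝔼-cong configs (λ c → ⊘-as-* (totalError c) (totalMass n)) ⟩
    𝔼 configs (λ c → totalError c * (1ℚ ⊘ totalMass n))
      ≡⟨ 𝔼-*ʳ configs totalError (1ℚ ⊘ totalMass n) ⟩
    𝔼 configs totalError * (1ℚ ⊘ totalMass n)
      ≤⟨ *-mono (0≤* (0≤ℕ→ℚ 1160) 0≤ι) (0≤1⊘ (totalMass n) 0<mass) 𝔼-totalError≤ 1⊘mass≤ ⟩
    ℕ→ℚ 1160 * ι * (ℕ→ℚ 2 * recip (lg n))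
      ≡⟨ rearrange ι (recip (lg n)) ⟩
    ℕ→ℚ 2320 * (ι * recip (lg n))
      ≡⟨ cong (ℕ→ℚ 2320 *_) (recip-* B (lg n)) ⟨
    ℕ→ℚ 2320 * recip (B ℕ.* lg n)
      ≡⟨ ⊘-ℕ (ℕ→ℚ 2320) (B ℕ.* lg n) (ℕₚ.*-mono-≤ 0<B 0<lg) ⟨
    ℕ→ℚ 2320 ⊘ ℕ→ℚ (B ℕ.* lg n) ∎
    where
    open ℚₚ.≤-Reasoning
    rearrange : ∀ a b → ℕ→ℚ 1160 * a * (ℕ→ℚ 2 * b) ≡ ℕ→ℚ 2320 * (a * b)
    rearrange = solve-∀ ℚ-ring

-- cT = 2 makes the number T - 1 = 2 lglg n - 1 of small tables odd and at least lglg n;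
-- cτ = 200 brings the expected weight of a small table down to 1/4 + 27/125 ≤ 1/2.
theorem2 : ∃[ cT ] ∃[ cτ ] (0 < cT × Positive cτ × ∃[ K ] ∃[ n₀ ]
    ((n B : ℕ) → n₀ ≤ n → lg n ≤ B →
    expectedWeightedError cT cτ n B ≤ℚ K ⊘ ℕ→ℚ (B Data.Nat.* lg n)))
theorem2 = 2 , ℕ→ℚ 200 , s≤s z≤n , _ , ℕ→ℚ 2320 , 4 , Bound.bound
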